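{- For $u,v,n \in \mathbb{N}$, let $C'_4(u,v,n)$ denote the number of partitions of $n$ into $u$ distinct parts congruent to $3$ modulo $4$ and $v$ distinct parts congruent to $1$ modulo $4$ (all parts distinct). Let $D'_4(u,v,n)$ denote the number of partitions $\lambda_1 + \cdots + \lambda_s$ of $n$ (positive integer parts, $\lambda_1\ge\cdots\ge\lambda_s$) such that $u$ equals the number of parts congruent to $0$ or $3$ modulo $4$ plus twice the number of parts congruent to $2$ modulo $8$, and $v$ equals the number of parts congruent to $0$ or $1$ modulo $4$ plus twice the number of parts congruent to $6$ modulo $8$, satisfying the following conditions: (1) for all $i$, $\lambda_i \neq 2$; (2) for all $1\le i<s$: $\lambda_i - \lambda_{i+1} \in \{5,6,8,9\}$ or $\geq 11$ if $\lambda_{i} \equiv 0 \pmod 8$; $\lambda_i - \lambda_{i+1} = 2$ or $\geq 5$ if $\lambda_{i} \equiv 1 \pmod 8$; $\lambda_i - \lambda_{i+1} = 11$ or $\geq 13$ if $\lambda_{i} \equiv 2 \pmod 8$; $\lambda_i - \lambda_{i+1} \geq 7$ if $\lambda_{i} \equiv 3 \pmod 8$; $\lambda_i - \lambda_{i+1} = 5$ or $\geq 7$ if $\lambda_{i} \equiv 4 \pmod 8$; $\lambda_i - \lambda_{i+1} \in \{2,3,5,6\}$ or $\geq 8$ if $\lambda_{i} \equiv 5 \pmod 8$; $\lambda_i - \lambda_{i+1} \in \{3,4,6,7\}$ or $\geq 9$ if $\lambda_{i} \equiv 6 \pmod 8$; $\lambda_i - \lambda_{i+1} = 8$ or $\geq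 10$ if $\lambda_{i} \equiv 7 \pmod 8$. Then $C'_4(u,v,n)=D'_4(u,v,n)$ for all $u,v,n\in\mathbb{N}$. -}

module Defs where

open import Data.Empty using (⊥)
open import Data.Fin.Base using (Fin)
open import Data.Fin.Patterns using (0F; 1F; 2F; 3F; 4F; 5F; 6F; 7F)
open import Data.List.Base using (List; []; _∷_; _++_; map; filter; length)
open import Data.List.Membership.Propositional using (_∈_)
open import Data.List.Membership.Propositional.Properties
  using (∈-++⁺ˡ; ∈-++⁺ʳ; ∈-++⁻; ∈-map⁺; ∈-map⁻; ∈-filter⁺; ∈-filter⁻)
open import Data.List.Properties using (∷-injectiveʳ)
open import Data.List.Relation.Unary.All using (All; []; _∷_; all?)
open import Data.List.Relation.Unary.AllPairs using ([]; _∷_)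
open import Data.List.Relation.Unary.Any using (here)
open import Data.List.Relation.Unary.Linked using (Linked; []; [-]; _∷_; linked?)
open import Data.List.Relation.Unary.Unique.Propositional using (Unique)
open import Data.List.Relation.Unary.Unique.Propositional.Properties
  using (++⁺; map⁺; filter⁺)
open import Data.Nat
  using (ℕ; zero; suc; _+_; _*_; _∸_; _%_; _≤_; _≥_; _>_; z≤n; s≤s; _≟_; _≥?_)
open import Data.Nat.DivMod using (_mod_)
open import Data.Nat.ListAction using (sum)
open import Data.Nat.Properties
  using (≤-refl; m≤n⇒m≤1+n; m≤n⇒m<n∨m≡n; <-irrefl; m≤m+n; +-mono-≤)
open import Data.Product using (_×_; _,_)
open import Data.Sum using (_⊎_; inj₁; inj₂)
open import Function using (_⇔_; mk⇔)
open import Relation.Binary using (Rel)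
open import Relation.Binary.PropositionalEquality using (_≡_; _≢_; refl)
open import Relation.Nullary using (Dec; ¬?)
open import Relation.Nullary.Decidable using (_×-dec_; _⊎-dec_)
open import Relation.Unary using (Pred; Decidable)
import Data.List.Membership.DecPropositional as DecMembership
import Data.List.Relation.Unary.Unique.DecPropositional as DecUnique

open DecMembership _≟_ using (_∈?_)
open DecUnique _≟_ using (unique?)

count : ∀ {a p} {A : Set a} {P : Pred A p} → Decidable P → List A → ℕ
count P? xs = length (filter P? xs)

-- A partition λ₁ + ⋯ + λₛ is the list λ₁ ∷ ⋯ ∷ λₛ ∷ [], largest part first.
IsPartition : ℕ → List ℕ → Set
IsPartition n xs = All (_> 0) xs × Linked _≥_ xs × sum xs ≡ n

-- Weakly decreasing lists of at most k positive parts, each at most m.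
box : (k m : ℕ) → List (List ℕ)
box zero    m       = [] ∷ []
box (suc k) zero    = [] ∷ []
box (suc k) (suc m) = box (suc k) m ++ map (suc m ∷_) (box k (suc m))

-- Every partition of n, exactly once: see ∈-partitions and partitions-unique.
partitions : ℕ → List (List ℕ)
partitions n = filter (λ xs → sum xs ≟ n) (box n n)

private
  raise : ∀ {m xs} → Linked _≥_ (m ∷ xs) → Linked _≥_ (suc m ∷ xs)
  raise [-]      = [-]
  raise (p ∷ ps) = m≤n⇒m≤1+n p ∷ ps

  tail≥ : ∀ {m xs} → Linked _≥_ (m ∷ xs) → Linked _≥_ xs
  tail≥ [-]      = []
  tail≥ (_ ∷ ps) = ps

  box-sound : ∀ k m {xs} → xs ∈ box k m → Linked _≥_ (m ∷ xs) × All (_> 0) xs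
  box-sound zero    m       (here refl) = [-] , []
  box-sound (suc k) zero    (here refl) = [-] , []
  box-sound (suc k) (suc m) xs∈ with ∈-++⁻ (box (suc k) m) xs∈
  ... | inj₁ p = let l , a = box-sound (suc k) m p in raise l , a
  ... | inj₂ p with ∈-map⁻ (suc m ∷_) p
  ...   | ys , ys∈ , refl =
            let l , a = box-sound k (suc m) ys∈ in ≤-refl ∷ l , s≤s z≤n ∷ a

  []∈box : ∀ k m → [] ∈ box k m
  []∈box zero    m       = here refl
  []∈box (suc k) zero    = here refl
  []∈box (suc k) (suc m) = ∈-++⁺ˡ ([]∈box (suc k) m)

  box-complete : ∀ k m {xs} → Linked _≥_ (m ∷ xs) → All (_> 0) xs →
                 length xs ≤ k → xs ∈ box k m
  box-complete k       m       {[]}     _        _          _       = []∈box k m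
  box-complete (suc k) zero    {x ∷ xs} (z≤n ∷ _) (() ∷ _)  _
  box-complete (suc k) (suc m) {x ∷ xs} (p ∷ l)  (q ∷ a)    (s≤s h)
    with m≤n⇒m<n∨m≡n p
  ... | inj₁ (s≤s x≤m) = ∈-++⁺ˡ (box-complete (suc k) m (x≤m ∷ l) (q ∷ a) (s≤s h))
  ... | inj₂ refl      = ∈-++⁺ʳ (box (suc k) m)
                           (∈-map⁺ (suc m ∷_) (box-complete k (suc m) l a h))

  box-unique : ∀ k m → Unique (box k m)
  box-unique zero    m       = [] ∷ []
  box-unique (suc k) zero    = [] ∷ []
  box-unique (suc k) (suc m) =
    ++⁺ (box-unique (suc k) m) (map⁺ ∷-injectiveʳ (box-unique k (suc m))) disjoint
    where
    disjoint : ∀ {xs} →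
               xs ∈ box (suc k) m × xs ∈ map (suc m ∷_) (box k (suc m)) → ⊥
    disjoint (p , q) with ∈-map⁻ (suc m ∷_) q
    ... | _ , _ , refl with box-sound (suc k) m p
    ...   | 1+m≤m ∷ _ , _ = <-irrefl refl 1+m≤m

  length≤sum : ∀ {xs} → All (_> 0) xs → length xs ≤ sum xs
  length≤sum []      = z≤n
  length≤sum (p ∷ a) = +-mono-≤ p (length≤sum a)

  head≤sum : ∀ {xs} → Linked _≥_ xs → Linked _≥_ (sum xs ∷ xs)
  head≤sum {[]}     _ = [-]
  head≤sum {x ∷ xs} l = m≤m+n x (sum xs) ∷ l

∈-partitions : ∀ n {xs} → xs ∈ partitions n ⇔ IsPartition n xs
∈-partitions n = mk⇔
  (λ xs∈ → let xs∈box , s = ∈-filter⁻ (λ xs → sum xs ≟ n) {xs = box n n} xs∈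
               l , a = box-sound n n xs∈box
           in a , tail≥ l , s)
  (λ { (a , l , refl) →
         ∈-filter⁺ (λ xs → sum xs ≟ n)
           (box-complete n n (head≤sum l) a (length≤sum a)) refl })

partitions-unique : ∀ n → Unique (partitions n)
partitions-unique n = filter⁺ (λ xs → sum xs ≟ n) (box-unique n n)

C′-Condition : (u v : ℕ) → List ℕ → Set
C′-Condition u v xs =
  Unique xs ×
  All (λ x → x % 4 ≡ 3 ⊎ x % 4 ≡ 1) xs ×
  count (λ x → x % 4 ≟ 3) xs ≡ u ×
  count (λ x → x % 4 ≟ 1) xs ≡ v

C′-condition? : ∀ u v → Decidable (C′-Condition u v)
C′-condition? u v xs =
  unique? xs ×-dec
  all? (λ x → (x % 4 ≟ 3) ⊎-dec (x % 4 ≟ 1)) xs ×-dec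
  (count (λ x → x % 4 ≟ 3) xs ≟ u) ×-dec
  (count (λ x → x % 4 ≟ 1) xs ≟ v)

C′₄ : (u v n : ℕ) → ℕ
C′₄ u v n = count (C′-condition? u v) (partitions n)

-- AllowedGap r d: a part congruent to r modulo 8 may exceed the next part by d.
AllowedGap : Fin 8 → ℕ → Set
AllowedGap 0F d = d ∈ 5 ∷ 6 ∷ 8 ∷ 9 ∷ [] ⊎ d ≥ 11
AllowedGap 1F d = d ≡ 2                  ⊎ d ≥ 5
AllowedGap 2F d = d ≡ 11                 ⊎ d ≥ 13
AllowedGap 3F d =                          d ≥ 7
AllowedGap 4F d = d ≡ 5                  ⊎ d ≥ 7
AllowedGap 5F d = d ∈ 2 ∷ 3 ∷ 5 ∷ 6 ∷ [] ⊎ d ≥ 8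
AllowedGap 6F d = d ∈ 3 ∷ 4 ∷ 6 ∷ 7 ∷ [] ⊎ d ≥ 9
AllowedGap 7F d = d ≡ 8                  ⊎ d ≥ 10

allowedGap? : ∀ r d → Dec (AllowedGap r d)
allowedGap? 0F d = (d ∈? 5 ∷ 6 ∷ 8 ∷ 9 ∷ []) ⊎-dec (d ≥? 11)
allowedGap? 1F d = (d ≟ 2)                   ⊎-dec (d ≥? 5)
allowedGap? 2F d = (d ≟ 11)                  ⊎-dec (d ≥? 13)
allowedGap? 3F d =                                  d ≥? 7
allowedGap? 4F d = (d ≟ 5)                   ⊎-dec (d ≥? 7)
allowedGap? 5F d = (d ∈? 2 ∷ 3 ∷ 5 ∷ 6 ∷ []) ⊎-dec (d ≥? 8)
allowedGap? 6F d = (d ∈? 3 ∷ 4 ∷ 6 ∷ 7 ∷ []) ⊎-dec (d ≥? 9)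
allowedGap? 7F d = (d ≟ 8)                   ⊎-dec (d ≥? 10)

-- For consecutive parts x ≥ y, so the truncated x ∸ y is the true difference.
GapOK : Rel ℕ _
GapOK x y = AllowedGap (x mod 8) (x ∸ y)

uWeight vWeight : List ℕ → ℕ
uWeight xs = count (λ x → (x % 4 ≟ 0) ⊎-dec (x % 4 ≟ 3)) xs
           + 2 * count (λ x → x % 8 ≟ 2) xs
vWeight xs = count (λ x → (x % 4 ≟ 0) ⊎-dec (x % 4 ≟ 1)) xs
           + 2 * count (λ x → x % 8 ≟ 6) xs

D′-Condition : (u v : ℕ) → List ℕ → Set
D′-Condition u v xs =
  u ≡ uWeight xs × v ≡ vWeight xs × All (_≢ 2) xs × Linked GapOK xs

D′-condition? : ∀ u v → Decidable (D′-Condition u v)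
D′-condition? u v xs =
  (u ≟ uWeight xs) ×-dec
  (v ≟ vWeight xs) ×-dec
  all? (λ x → ¬? (x ≟ 2)) xs ×-dec
  linked? (λ x y → allowedGap? (x mod 8) (x ∸ y)) xs

D′₄ : (u v n : ℕ) → ℕ
D′₄ u v n = count (D′-condition? u v) (partitions n)

{-# OPTIONS --safe #-}
module Submission where

-- Mark the parts ≡ 3 and ≡ 1 (mod 4) by a and b, and rescale q so that they become
-- a qⁱ and b qⁱ; an even part then weighs as much as two odd ones. The gap
-- conditions say that the parts allowed after x form an initial segment of a
-- suitable preorder of ℕ. Truncating the generating function of the D′-partitions
-- along this preorder gives T₀ k, T₁ k, T₂ k, T₃ k, T₀ (k + 1), …, for which the
-- recurrences yield T₃ k = Λ (T₂ k) and T₀ (k + 1) = Λ (T₃ k), where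
-- Λ φ (a , b) = (1 + a q) φ (b , a q). The products of the factors 1 + a qⁱ and
-- 1 + b qⁱ obey the same equation. As T₀ k and T₂ k agree in low degrees, so do
-- T₀ k and the product.

open import Defs
open import Data.Bool.Base using (if_then_else_)
open import Data.Empty using (⊥)
open import Data.Fin.Base using (Fin; toℕ; fromℕ<)
open import Data.Fin.Patterns using (0F; 1F; 2F; 3F; 4F; 5F; 6F; 7F)
open import Data.Fin.Properties using (all?; toℕ-fromℕ<; toℕ<n)
open import Data.List.Base using (List; []; _∷_; _++_; map; concatMap)
open import Data.List.Membership.Propositional using (_∈_)
open import Data.List.Membership.Propositional.Properties using (∈-++⁺ˡ; ∈-++⁺ʳ; ∈-++⁻; ∈-map⁺; ∈-map⁻; ∈-filter⁺; ∈-filter⁻)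
open import Data.List.Membership.Propositional.Properties.WithK using (unique∧set⇒bag)
open import Data.List.Properties using (map-++; map-∘; map-cong; ∷-injectiveʳ)
open import Data.List.Relation.Binary.BagAndSetEquality using (∼bag⇒↭)
open import Data.List.Relation.Binary.Permutation.Propositional.Properties using (↭-length)
open import Data.List.Relation.Unary.All as All using (All; []; _∷_)
open import Data.List.Relation.Unary.All.Properties using (All¬⇒¬Any)
open import Data.List.Relation.Unary.AllPairs as AllPairs using ([]; _∷_)
open import Data.List.Relation.Unary.Any using (here; there)
open import Data.List.Relation.Unary.Linked as Linked using (Linked; []; [-]; _∷_)
open import Data.List.Relation.Unary.Linked.Properties using (Linked⇒AllPairs; AllPairs⇒Linked)
open import Data.List.Relation.Unary.Unique.Propositional using (Unique)
open import Data.List.Relation.Unary.Unique.Propositional.Properties using (++⁺; map⁺; filter⁺)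
open import Data.Nat
open import Data.Nat.DivMod using (_mod_)
open import Data.Nat.Induction using (<-rec)
open import Data.Nat.ListAction using (sum)
open import Data.Nat.ListAction.Properties using (sum-++)
open import Data.Nat.Properties
open import Data.Nat.Tactic.RingSolver using (solve-∀)
open import Data.Product using (_×_; _,_; proj₁; proj₂; ∃)
open import Data.Sum using (_⊎_; inj₁; inj₂)
open import Function using (_∘_; _⇔_; mk⇔; Equivalence)
open import Level using (0ℓ)
open import Relation.Binary using (Rel)
open import Relation.Binary.PropositionalEquality
open import Relation.Nullary using (¬_; Dec; ¬?; yes; no; does)
open import Relation.Nullary.Decidable using (True; toWitness; from-yes; from-no; dec-false; _→-dec_; _×-dec_; _⊎-dec_)
open import Relation.Nullary.Negation using (contradiction)
open import Relation.Unary using (Pred; Decidable)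
import Data.List.Membership.DecPropositional as DecMembership
import Data.List.Relation.Unary.Unique.DecPropositional as DecUnique
open DecMembership _≟_ using (_∈?_)
open DecUnique _≟_ using (unique?)

-- Generating functions and their functional equations

interchange : ∀ a b c d → a + b + (c + d) ≡ a + c + (b + d)
interchange = solve-∀

Weight : Set
Weight = ℕ × ℕ × ℕ

infixl 6 _⊕_
_⊕_ : Weight → Weight → Weight
(u , v , s) ⊕ (u′ , v′ , s′) = u + u′ , v + v′ , s + s′

cong₃ : ∀ {u u′ v v′ s s′ : ℕ} → u ≡ u′ → v ≡ v′ → s ≡ s′ → (u , v , s) ≡ (u′ , v′ , s′)
cong₃ refl refl refl = refl

⊕-assoc : ∀ p q r → (p ⊕ q) ⊕ r ≡ p ⊕ (q ⊕ r)
⊕-assoc (u , v , s) (u′ , v′ , s′) (u″ , v″ , s″) =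
  cong₃ (+-assoc u u′ u″) (+-assoc v v′ v″) (+-assoc s s′ s″)

⊕-comm : ∀ p q → p ⊕ q ≡ q ⊕ p
⊕-comm (u , v , s) (u′ , v′ , s′) = cong₃ (+-comm u u′) (+-comm v v′) (+-comm s s′)

-- A part x standing for u factors a and v factors b gets s = (x + u + 3 v) / 4,
-- so that the parts 3, 7, 11, … become a q, a q², a q³, … and the parts
-- 1, 5, 9, … become b q, b q², b q³, ….
ω : ℕ → Weight
ω 0 = 1 , 1 , 1
ω 1 = 0 , 1 , 1
ω 2 = 2 , 0 , 1
ω 3 = 1 , 0 , 1
ω 4 = 1 , 1 , 2
ω 5 = 0 , 1 , 2
ω 6 = 0 , 2 , 3
ω 7 = 1 , 0 , 2
ω (suc (suc (suc (suc (suc (suc (suc (suc x)))))))) = (0 , 0 , 2) ⊕ ω x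

weight : List ℕ → Weight
weight []       = 0 , 0 , 0
weight (x ∷ xs) = ω x ⊕ weight xs

ω-periodic : ∀ r k → ω (r + k * 8) ≡ (0 , 0 , k * 2) ⊕ ω r
ω-periodic r k = trans (cong ω (+-comm r (k * 8))) (go k)
  where
  go : ∀ k → ω (k * 8 + r) ≡ (0 , 0 , k * 2) ⊕ ω r
  go zero    = refl
  go (suc k) = cong ((0 , 0 , 2) ⊕_) (go k)

-- A polynomial Σ c(w) w in a, b, q is represented by the functional
-- f ↦ Σ c(w) f(w): multiplication by w turns into f ↦ w ▷ f, and coefficients are
-- read off with indicator functions f.
Test : Set
Test = Weight → ℕ

infixr 7 _▷_
_▷_ : Weight → Test → Test
(w ▷ f) p = f (w ⊕ p)

⟦_⟧ : List (List ℕ) → Test → ℕ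
⟦ L ⟧ f = sum (map (f ∘ weight) L)

⟦⟧-cong : ∀ L {f g : Test} → f ≗ g → ⟦ L ⟧ f ≡ ⟦ L ⟧ g
⟦⟧-cong L f≗g = cong sum (map-cong (λ xs → f≗g (weight xs)) L)

⟦⟧-++ : ∀ L M f → ⟦ L ++ M ⟧ f ≡ ⟦ L ⟧ f + ⟦ M ⟧ f
⟦⟧-++ L M f =
  trans (cong sum (map-++ (f ∘ weight) L M)) (sum-++ (map (f ∘ weight) L) _)

⟦⟧-map : ∀ x L f → ⟦ map (x ∷_) L ⟧ f ≡ ⟦ L ⟧ (ω x ▷ f)
⟦⟧-map x L f = cong sum (sym (map-∘ L))

prepend : List (ℕ × List (List ℕ)) → List (List ℕ)
prepend = concatMap (λ (x , L) → map (x ∷_) L)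

⟦⟧-prepend : ∀ x L ps f →
             ⟦ prepend ((x , L) ∷ ps) ⟧ f ≡ ⟦ L ⟧ (ω x ▷ f) + ⟦ prepend ps ⟧ f
⟦⟧-prepend x L ps f =
  trans (⟦⟧-++ (map (x ∷_) L) (prepend ps) f) (cong (_+ ⟦ prepend ps ⟧ f) (⟦⟧-map x L f))

⟦⟧-++-prepend₁ : ∀ K x L f →
                 ⟦ K ++ prepend ((x , L) ∷ []) ⟧ f ≡ ⟦ K ⟧ f + ⟦ L ⟧ (ω x ▷ f)
⟦⟧-++-prepend₁ K x L f =
  trans (⟦⟧-++ K _ f)
        (cong (⟦ K ⟧ f +_) (trans (⟦⟧-prepend x L [] f) (+-identityʳ _)))

⟦⟧-++-prepend₃ : ∀ K x L y M z N f →
  ⟦ K ++ prepend ((x , L) ∷ (y , M) ∷ (z , N) ∷ []) ⟧ f ≡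
  ⟦ K ⟧ f + (⟦ L ⟧ (ω x ▷ f) + (⟦ M ⟧ (ω y ▷ f) + ⟦ N ⟧ (ω z ▷ f)))
⟦⟧-++-prepend₃ K x L y M z N f =
  trans (⟦⟧-++ K _ f) (cong (⟦ K ⟧ f +_)
    (trans (⟦⟧-prepend x L ((y , M) ∷ (z , N) ∷ []) f) (cong (⟦ L ⟧ (ω x ▷ f) +_)
      (trans (⟦⟧-prepend y M ((z , N) ∷ []) f) (cong (⟦ M ⟧ (ω y ▷ f) +_)
        (trans (⟦⟧-prepend z N [] f) (+-identityʳ _)))))))

-- The substitution (a , b) ↦ (b , a q).
σ : Weight → Weight
σ (u , v , s) = v , u , v + s

σ-⊕ : ∀ p q → σ (p ⊕ q) ≡ σ p ⊕ σ q
σ-⊕ (u , v , s) (u′ , v′ , s′) = cong₃ refl refl (interchange v v′ s s′)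

-- φ (a , b) ↦ (1 + a q) φ (b , a q).
Λ : (Test → ℕ) → Test → ℕ
Λ φ f = φ (f ∘ σ) + φ ((ω 3 ▷ f) ∘ σ)

Λ-cong : ∀ {φ ψ : Test → ℕ} → φ ≗ ψ → Λ φ ≗ Λ ψ
Λ-cong e f = cong₂ _+_ (e _) (e _)

Λ-+ : ∀ (φ ψ : Test → ℕ) f → Λ (λ g → φ g + ψ g) f ≡ Λ φ f + Λ ψ f
Λ-+ φ ψ f = interchange (φ (f ∘ σ)) (ψ (f ∘ σ)) (φ ((ω 3 ▷ f) ∘ σ)) (ψ ((ω 3 ▷ f) ∘ σ))

-- Substitution is multiplicative, so a factor `w` inside `φ` comes out as `σ w`, which then
-- commutes with the factor 1 + a q of `Λ`.
Λ-▷ : ∀ φ → (∀ {f g} → f ≗ g → φ f ≡ φ g) → ∀ w w′ → σ w ≡ w′ →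
      ∀ f → Λ (λ g → φ (w ▷ g)) f ≡ Λ φ (w′ ▷ f)
Λ-▷ φ φ-cong w _ refl f = cong₂ _+_
  (φ-cong λ p → cong f (σ-⊕ w p))
  (φ-cong λ p → cong f (begin
    ω 3 ⊕ σ (w ⊕ p)     ≡⟨ cong (ω 3 ⊕_) (σ-⊕ w p) ⟩
    ω 3 ⊕ (σ w ⊕ σ p)   ≡⟨ ⊕-assoc (ω 3) (σ w) (σ p) ⟨
    ω 3 ⊕ σ w ⊕ σ p     ≡⟨ cong (_⊕ σ p) (⊕-comm (ω 3) (σ w)) ⟩
    σ w ⊕ ω 3 ⊕ σ p     ≡⟨ ⊕-assoc (σ w) (ω 3) (σ p) ⟩
    σ w ⊕ (ω 3 ⊕ σ p)   ∎))
  where open ≡-Reasoning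

-- Recurrences for the truncated generating functions

-- The chains whose parts have rank at most 7 + 4k, 8 + 4k, 9 + 4k and 10 + 4k, for the
-- rank defined below; T₂⁻ k and T₃⁻ k stand for T₂ (k - 1) and T₃ (k - 1).
T₀ T₁ T₂ T₃ T₂⁻ T₃⁻ : ℕ → List (List ℕ)
T₂⁻ zero    = [] ∷ []
T₂⁻ (suc k) = T₂ k
T₃⁻ zero    = ([] ∷ []) ++ prepend ((3 , [] ∷ []) ∷ [])
T₃⁻ (suc k) = T₃ k
T₀ zero     = T₃⁻ 0 ++ prepend ((1 , [] ∷ []) ∷ (4 , [] ∷ []) ∷ [])
T₀ (suc k)  = T₃ k ++ prepend ((6 + k * 8 , T₃⁻ k) ∷ (9 + k * 8 , T₁ k) ∷ (12 + k * 8 , T₂ k) ∷ [])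
T₁ k        = T₀ k ++ prepend ((7 + k * 8 , T₂⁻ k) ∷ [])
T₂ k        = T₁ k ++ prepend ((5 + k * 8 , T₃⁻ k) ∷ [])
T₃ k        = T₂ k ++ prepend ((8 + k * 8 , T₃⁻ k) ∷ (10 + k * 8 , T₂⁻ k) ∷ (11 + k * 8 , T₀ k) ∷ [])

infixl 6 _⊞_
_⊞_ : (Test → ℕ) → (Test → ℕ) → Test → ℕ
(φ ⊞ ψ) f = φ f + ψ f

Λ-+₄ : ∀ φ ψ χ ξ → Λ (φ ⊞ (ψ ⊞ (χ ⊞ ξ))) ≗ Λ φ ⊞ (Λ ψ ⊞ (Λ χ ⊞ Λ ξ))
Λ-+₄ φ ψ χ ξ f = trans (Λ-+ φ (ψ ⊞ (χ ⊞ ξ)) f) (cong (Λ φ f +_)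
  (trans (Λ-+ ψ (χ ⊞ ξ) f) (cong (Λ ψ f +_) (Λ-+ χ ξ f))))

infixr 7 _·_
_·_ : ℕ → (Test → ℕ) → Test → ℕ
(x · φ) f = φ (ω x ▷ f)

T₀-eq : ∀ k →
        ⟦ T₀ (suc k) ⟧ ≗ ⟦ T₃ k ⟧ ⊞ ((6 + k * 8) · ⟦ T₃⁻ k ⟧ ⊞ ((9 + k * 8) · ⟦ T₁ k ⟧ ⊞ (12 + k * 8) · ⟦ T₂ k ⟧))
T₀-eq k = ⟦⟧-++-prepend₃ (T₃ k) (6 + k * 8) (T₃⁻ k) (9 + k * 8) (T₁ k) (12 + k * 8) (T₂ k)

T₁-eq : ∀ k → ⟦ T₁ k ⟧ ≗ ⟦ T₀ k ⟧ ⊞ (7 + k * 8) · ⟦ T₂⁻ k ⟧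
T₁-eq k = ⟦⟧-++-prepend₁ (T₀ k) (7 + k * 8) (T₂⁻ k)

T₂-eq : ∀ k → ⟦ T₂ k ⟧ ≗ ⟦ T₁ k ⟧ ⊞ (5 + k * 8) · ⟦ T₃⁻ k ⟧
T₂-eq k = ⟦⟧-++-prepend₁ (T₁ k) (5 + k * 8) (T₃⁻ k)

T₂-T₀-eq : ∀ k →
        ⟦ T₂ k ⟧ ≗ ⟦ T₀ k ⟧ ⊞ (7 + k * 8) · ⟦ T₂⁻ k ⟧ ⊞ (5 + k * 8) · ⟦ T₃⁻ k ⟧
T₂-T₀-eq k f = trans (T₂-eq k f) (cong (_+ ((5 + k * 8) · ⟦ T₃⁻ k ⟧) f) (T₁-eq k f))

T₃-eq : ∀ k →
        ⟦ T₃ k ⟧ ≗ ⟦ T₂ k ⟧ ⊞ ((8 + k * 8) · ⟦ T₃⁻ k ⟧ ⊞ ((10 + k * 8) · ⟦ T₂⁻ k ⟧ ⊞ (11 + k * 8) · ⟦ T₀ k ⟧))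
T₃-eq k = ⟦⟧-++-prepend₃ (T₂ k) (8 + k * 8) (T₃⁻ k) (10 + k * 8) (T₂⁻ k) (11 + k * 8) (T₀ k)

-- `σ` turns the weight of one part into that of another and fixes the powers of q, so it is enough
-- to compare weights at k = 0. Under `Λ`, the block of chains led by the one part becomes a block
-- led by the other.
Λ-· : ∀ L {φ} r r′ k → σ (ω r) ≡ ω r′ → Λ ⟦ L ⟧ ≗ φ →
      Λ ((r + k * 8) · ⟦ L ⟧) ≗ (r′ + k * 8) · φ
Λ-· L r r′ k e ΛL≗φ f =
  trans (Λ-▷ ⟦ L ⟧ (⟦⟧-cong L) (ω (r + k * 8)) (ω (r′ + k * 8)) shifted f) (ΛL≗φ _)
  where
  open ≡-Reasoning
  shifted : σ (ω (r + k * 8)) ≡ ω (r′ + k * 8)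
  shifted = begin
    σ (ω (r + k * 8))            ≡⟨ cong σ (ω-periodic r k) ⟩
    σ ((0 , 0 , k * 2) ⊕ ω r)    ≡⟨ σ-⊕ (0 , 0 , k * 2) (ω r) ⟩
    (0 , 0 , k * 2) ⊕ σ (ω r)    ≡⟨ cong ((0 , 0 , k * 2) ⊕_) e ⟩
    (0 , 0 , k * 2) ⊕ ω r′       ≡⟨ ω-periodic r′ k ⟨
    ω (r′ + k * 8)               ∎

-- Only the total weight of the two leading parts matters. This trades a pair with a forbidden gap,
-- such as 9 and 8, for an allowed one, such as 12 and 5.
·-swap : ∀ L r₁ r₂ r₃ r₄ k → ω r₁ ⊕ ω r₂ ≡ ω r₃ ⊕ ω r₄ →
         (r₁ + k * 8) · (r₂ + k * 8) · ⟦ L ⟧ ≗ (r₃ + k * 8) · (r₄ + k * 8) · ⟦ L ⟧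
·-swap L r₁ r₂ r₃ r₄ k e f = ⟦⟧-cong L λ p → cong f (begin
  ω (r₁ + k * 8) ⊕ (ω (r₂ + k * 8) ⊕ p)         ≡⟨ ⊕-assoc (ω (r₁ + k * 8)) (ω (r₂ + k * 8)) p ⟨
  ω (r₁ + k * 8) ⊕ ω (r₂ + k * 8) ⊕ p           ≡⟨ cong (_⊕ p) (split r₁ r₂) ⟩
  (0 , 0 , k * 2 + k * 2) ⊕ (ω r₁ ⊕ ω r₂) ⊕ p   ≡⟨ cong (λ w → (0 , 0 , k * 2 + k * 2) ⊕ w ⊕ p) e ⟩
  (0 , 0 , k * 2 + k * 2) ⊕ (ω r₃ ⊕ ω r₄) ⊕ p   ≡⟨ cong (_⊕ p) (split r₃ r₄) ⟨
  ω (r₃ + k * 8) ⊕ ω (r₄ + k * 8) ⊕ p           ≡⟨ ⊕-assoc (ω (r₃ + k * 8)) (ω (r₄ + k * 8)) p ⟩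
  ω (r₃ + k * 8) ⊕ (ω (r₄ + k * 8) ⊕ p)         ∎)
  where
  open ≡-Reasoning
  split : ∀ r r′ → ω (r + k * 8) ⊕ ω (r′ + k * 8) ≡ (0 , 0 , k * 2 + k * 2) ⊕ (ω r ⊕ ω r′)
  split r r′ = trans (cong₂ _⊕_ (ω-periodic r k) (ω-periodic r′ k))
    (cong₃ refl refl (interchange (k * 2) (proj₂ (proj₂ (ω r))) (k * 2) (proj₂ (proj₂ (ω r′)))))

-- The field Λ-T₀ yields Λ-T₁, and with it Λ-T₂ and Λ-T₃, without any subtraction.
record Shifts (k : ℕ) : Set where
  field
    Λ-T₂⁻ : Λ ⟦ T₂⁻ k ⟧ ≗ ⟦ T₃⁻ k ⟧
    Λ-T₃⁻ : Λ ⟦ T₃⁻ k ⟧ ≗ ⟦ T₀ k ⟧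
    Λ-T₀  : Λ ⟦ T₀ k ⟧ ≗ ⟦ T₀ k ⟧ ⊞
            ((7 + k * 8) · ⟦ T₂⁻ k ⟧ ⊞ ((8 + k * 8) · ⟦ T₃⁻ k ⟧ ⊞ (10 + k * 8) · ⟦ T₂⁻ k ⟧))

  Λ-T₁ : Λ ⟦ T₁ k ⟧ ≗ ⟦ T₂ k ⟧ ⊞ ((8 + k * 8) · ⟦ T₃⁻ k ⟧ ⊞ (10 + k * 8) · ⟦ T₂⁻ k ⟧)
  Λ-T₁ f = begin
    Λ ⟦ T₁ k ⟧ f
      ≡⟨ Λ-cong (T₁-eq k) f ⟩
    Λ (⟦ T₀ k ⟧ ⊞ (7 + k * 8) · ⟦ T₂⁻ k ⟧) f
      ≡⟨ Λ-+ ⟦ T₀ k ⟧ ((7 + k * 8) · ⟦ T₂⁻ k ⟧) f ⟩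
    Λ ⟦ T₀ k ⟧ f + Λ ((7 + k * 8) · ⟦ T₂⁻ k ⟧) f
      ≡⟨ cong₂ _+_ (Λ-T₀ f) (Λ-· (T₂⁻ k) 7 5 k refl Λ-T₂⁻ f) ⟩
    ⟦ T₀ k ⟧ f + (e₇ + e₈₁₀) + e₅
      ≡⟨ rearrange (⟦ T₀ k ⟧ f) e₇ e₈₁₀ e₅ ⟩
    ⟦ T₀ k ⟧ f + e₇ + e₅ + e₈₁₀
      ≡⟨ cong (λ t → t + e₅ + e₈₁₀) (T₁-eq k f) ⟨
    ⟦ T₁ k ⟧ f + e₅ + e₈₁₀
      ≡⟨ cong (_+ e₈₁₀) (T₂-eq k f) ⟨
    ⟦ T₂ k ⟧ f + e₈₁₀ ∎
    where
    open ≡-Reasoning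
    e₅ e₇ e₈₁₀ : ℕ
    e₅ = ((5 + k * 8) · ⟦ T₃⁻ k ⟧) f
    e₇ = ((7 + k * 8) · ⟦ T₂⁻ k ⟧) f
    e₈₁₀ = ((8 + k * 8) · ⟦ T₃⁻ k ⟧ ⊞ (10 + k * 8) · ⟦ T₂⁻ k ⟧) f
    rearrange : ∀ a b c d → a + (b + c) + d ≡ a + b + d + c
    rearrange = solve-∀

  Λ-T₂ : Λ ⟦ T₂ k ⟧ ≗ ⟦ T₃ k ⟧
  Λ-T₂ f = begin
    Λ ⟦ T₂ k ⟧ f
      ≡⟨ Λ-cong (T₂-eq k) f ⟩
    Λ (⟦ T₁ k ⟧ ⊞ (5 + k * 8) · ⟦ T₃⁻ k ⟧) f
      ≡⟨ Λ-+ ⟦ T₁ k ⟧ ((5 + k * 8) · ⟦ T₃⁻ k ⟧) f ⟩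
    Λ ⟦ T₁ k ⟧ f + Λ ((5 + k * 8) · ⟦ T₃⁻ k ⟧) f
      -- The block of 5 + 8k turns into that of 11 + 8k, the only one of `T₃ k` missing from `Λ-T₁`.
      ≡⟨ cong₂ _+_ (Λ-T₁ f) (Λ-· (T₃⁻ k) 5 11 k refl Λ-T₃⁻ f) ⟩
    ⟦ T₂ k ⟧ f + (e₈ + e₁₀) + e₁₁
      ≡⟨ rearrange (⟦ T₂ k ⟧ f) e₈ e₁₀ e₁₁ ⟩
    ⟦ T₂ k ⟧ f + (e₈ + (e₁₀ + e₁₁))
      ≡⟨ T₃-eq k f ⟨
    ⟦ T₃ k ⟧ f ∎
    where
    open ≡-Reasoning
    e₈ e₁₀ e₁₁ : ℕ
    e₈ = ((8 + k * 8) · ⟦ T₃⁻ k ⟧) f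
    e₁₀ = ((10 + k * 8) · ⟦ T₂⁻ k ⟧) f
    e₁₁ = ((11 + k * 8) · ⟦ T₀ k ⟧) f
    rearrange : ∀ a b c d → a + (b + c) + d ≡ a + (b + (c + d))
    rearrange = solve-∀

  Λ-T₃ : Λ ⟦ T₃ k ⟧ ≗ ⟦ T₀ (suc k) ⟧
  Λ-T₃ f = begin
    Λ ⟦ T₃ k ⟧ f
      ≡⟨ Λ-cong (T₃-eq k) f ⟩
    Λ (⟦ T₂ k ⟧ ⊞ ((8 + k * 8) · ⟦ T₃⁻ k ⟧ ⊞ ((10 + k * 8) · ⟦ T₂⁻ k ⟧ ⊞ (11 + k * 8) · ⟦ T₀ k ⟧))) f
      ≡⟨ Λ-+₄ ⟦ T₂ k ⟧ ((8 + k * 8) · ⟦ T₃⁻ k ⟧) ((10 + k * 8) · ⟦ T₂⁻ k ⟧) ((11 + k * 8) · ⟦ T₀ k ⟧) f ⟩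
    Λ ⟦ T₂ k ⟧ f + (Λ ((8 + k * 8) · ⟦ T₃⁻ k ⟧) f + (Λ ((10 + k * 8) · ⟦ T₂⁻ k ⟧) f + Λ ((11 + k * 8) · ⟦ T₀ k ⟧) f))
      ≡⟨ cong₂ _+_ (Λ-T₂ f) (cong₂ _+_ (Λ-· (T₃⁻ k) 8 12 k refl Λ-T₃⁻ f)
          (cong₂ _+_ (Λ-· (T₂⁻ k) 10 6 k refl Λ-T₂⁻ f) (Λ-· (T₀ k) 11 9 k refl Λ-T₀ f))) ⟩
    ⟦ T₃ k ⟧ f + (e₁₂ + (e₆ + (e₉ + (e₉₇ +
      (((9 + k * 8) · (8 + k * 8) · ⟦ T₃⁻ k ⟧) f +
       ((9 + k * 8) · (10 + k * 8) · ⟦ T₂⁻ k ⟧) f)))))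
      -- The extra terms of `Λ-T₀` occur here behind 9 + 8k. Up to 8k, the forbidden pairs 9, 8 and
      -- 9, 10 become 12, 5 and 12, 7, which complete the block of 12.
      ≡⟨ cong (λ t → ⟦ T₃ k ⟧ f + (e₁₂ + (e₆ + (e₉ + (e₉₇ + t)))))
          (cong₂ _+_ (·-swap (T₃⁻ k) 9 8 12 5 k refl f) (·-swap (T₂⁻ k) 9 10 12 7 k refl f)) ⟩
    ⟦ T₃ k ⟧ f + (e₁₂ + (e₆ + (e₉ + (e₉₇ + (e₁₂₅ + e₁₂₇)))))
      ≡⟨ rearrange (⟦ T₃ k ⟧ f) e₁₂ e₆ e₉ e₉₇ e₁₂₅ e₁₂₇ ⟩
    ⟦ T₃ k ⟧ f + (e₆ + (e₉ + e₉₇ + (e₁₂ + e₁₂₇ + e₁₂₅)))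
      ≡⟨ cong (λ t → ⟦ T₃ k ⟧ f + (e₆ + t)) (cong₂ _+_ (T₁-eq k (ω (9 + k * 8) ▷ f)) (T₂-T₀-eq k (ω (12 + k * 8) ▷ f))) ⟨
    ⟦ T₃ k ⟧ f + (e₆ + (((9 + k * 8) · ⟦ T₁ k ⟧) f + ((12 + k * 8) · ⟦ T₂ k ⟧) f))
      ≡⟨ T₀-eq k f ⟨
    ⟦ T₀ (suc k) ⟧ f ∎
    where
    open ≡-Reasoning
    e₆ e₉ e₁₂ e₉₇ e₁₂₅ e₁₂₇ : ℕ
    e₉ = ((9 + k * 8) · ⟦ T₀ k ⟧) f
    e₁₂ = ((12 + k * 8) · ⟦ T₀ k ⟧) f
    e₆ = ((6 + k * 8) · ⟦ T₃⁻ k ⟧) f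
    e₉₇ = ((9 + k * 8) · (7 + k * 8) · ⟦ T₂⁻ k ⟧) f
    e₁₂₅ = ((12 + k * 8) · (5 + k * 8) · ⟦ T₃⁻ k ⟧) f
    e₁₂₇ = ((12 + k * 8) · (7 + k * 8) · ⟦ T₂⁻ k ⟧) f
    rearrange : ∀ a b c d e g h → a + (b + (c + (d + (e + (g + h))))) ≡ a + (c + (d + e + (b + h + g)))
    rearrange = solve-∀

  -- This is the field `Λ-T₀` for `suc k`, since 15, 16, 18 are 7, 8, 10 raised by 8. The extra
  -- terms of `Λ-T₁`, after an exchange of pairs, complete the block of 18 + 8k.
  Λ-T₀′ : Λ ⟦ T₀ (suc k) ⟧ ≗ ⟦ T₀ (suc k) ⟧ ⊞
          ((15 + k * 8) · ⟦ T₂ k ⟧ ⊞ ((16 + k * 8) · ⟦ T₃ k ⟧ ⊞ (18 + k * 8) · ⟦ T₂ k ⟧))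
  Λ-T₀′ f = begin
    Λ ⟦ T₀ (suc k) ⟧ f
      ≡⟨ Λ-cong (T₀-eq k) f ⟩
    Λ (⟦ T₃ k ⟧ ⊞ ((6 + k * 8) · ⟦ T₃⁻ k ⟧ ⊞ ((9 + k * 8) · ⟦ T₁ k ⟧ ⊞ (12 + k * 8) · ⟦ T₂ k ⟧))) f
      ≡⟨ Λ-+₄ ⟦ T₃ k ⟧ ((6 + k * 8) · ⟦ T₃⁻ k ⟧) ((9 + k * 8) · ⟦ T₁ k ⟧) ((12 + k * 8) · ⟦ T₂ k ⟧) f ⟩
    Λ ⟦ T₃ k ⟧ f + (Λ ((6 + k * 8) · ⟦ T₃⁻ k ⟧) f + (Λ ((9 + k * 8) · ⟦ T₁ k ⟧) f + Λ ((12 + k * 8) · ⟦ T₂ k ⟧) f))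
      ≡⟨ cong₂ _+_ (Λ-T₃ f) (cong₂ _+_ (Λ-· (T₃⁻ k) 6 18 k refl Λ-T₃⁻ f)
          (cong₂ _+_ (Λ-· (T₁ k) 9 15 k refl Λ-T₁ f) (Λ-· (T₂ k) 12 16 k refl Λ-T₂ f))) ⟩
    ⟦ T₀ (suc k) ⟧ f + (e₁₈ + (e₁₅ + (((15 + k * 8) · (8 + k * 8) · ⟦ T₃⁻ k ⟧) f +
      ((15 + k * 8) · (10 + k * 8) · ⟦ T₂⁻ k ⟧) f) + e₁₆))
      ≡⟨ cong (λ t → ⟦ T₀ (suc k) ⟧ f + (e₁₈ + (e₁₅ + t + e₁₆)))
          (cong₂ _+_ (·-swap (T₃⁻ k) 15 8 18 5 k refl f) (·-swap (T₂⁻ k) 15 10 18 7 k refl f)) ⟩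
    ⟦ T₀ (suc k) ⟧ f + (e₁₈ + (e₁₅ + (e₁₈₅ + e₁₈₇) + e₁₆))
      ≡⟨ rearrange (⟦ T₀ (suc k) ⟧ f) e₁₈ e₁₅ e₁₈₅ e₁₈₇ e₁₆ ⟩
    ⟦ T₀ (suc k) ⟧ f + (e₁₅ + (e₁₆ + (e₁₈ + e₁₈₇ + e₁₈₅)))
      ≡⟨ cong (λ t → ⟦ T₀ (suc k) ⟧ f + (e₁₅ + (e₁₆ + t))) (T₂-T₀-eq k (ω (18 + k * 8) ▷ f)) ⟨
    ⟦ T₀ (suc k) ⟧ f + (e₁₅ + (e₁₆ + ((18 + k * 8) · ⟦ T₂ k ⟧) f)) ∎
    where
    open ≡-Reasoning
    e₁₅ e₁₆ e₁₈ e₁₈₅ e₁₈₇ : ℕ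
    e₁₈ = ((18 + k * 8) · ⟦ T₀ k ⟧) f
    e₁₅ = ((15 + k * 8) · ⟦ T₂ k ⟧) f
    e₁₆ = ((16 + k * 8) · ⟦ T₃ k ⟧) f
    e₁₈₅ = ((18 + k * 8) · (5 + k * 8) · ⟦ T₃⁻ k ⟧) f
    e₁₈₇ = ((18 + k * 8) · (7 + k * 8) · ⟦ T₂⁻ k ⟧) f
    rearrange : ∀ a b c d e g → a + (b + (c + (d + e) + g)) ≡ a + (c + (g + (b + e + d)))
    rearrange = solve-∀

shifts : ∀ k → Shifts k
shifts zero = record
  -- The series are 1, 1 + a q and (1 + a q)(1 + b q); both sides of the last field expand to (1 + a
  -- q)(1 + b q)(1 + a q²).
  { Λ-T₂⁻ = λ f → lemma₂ (f (0 , 0 , 0)) (f (1 , 0 , 1))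
  ; Λ-T₃⁻ = λ f → lemma₃ (f (0 , 0 , 0)) (f (1 , 0 , 1)) (f (0 , 1 , 1)) (f (1 , 1 , 2))
  ; Λ-T₀  = λ f → lemma₀ (f (0 , 0 , 0)) (f (1 , 0 , 1)) (f (0 , 1 , 1)) (f (1 , 1 , 2))
                         (f (1 , 0 , 2)) (f (1 , 1 , 3)) (f (2 , 0 , 3)) (f (2 , 1 , 4))
  }
  where
  lemma₂ : ∀ a b → a + 0 + (b + 0) ≡ a + (b + 0)
  lemma₂ = solve-∀
  lemma₃ : ∀ a b c d → a + (c + 0) + (b + (d + 0)) ≡ a + (b + (c + (d + 0)))
  lemma₃ = solve-∀
  lemma₀ : ∀ a b c d e g h i →
    a + (c + (e + (g + 0))) + (b + (d + (h + (i + 0)))) ≡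
    a + (b + (c + (d + 0))) + (e + 0 + (g + (i + 0) + (h + 0)))
  lemma₀ = solve-∀
shifts (suc k) = record { Λ-T₂⁻ = Λ-T₂ ; Λ-T₃⁻ = Λ-T₃ ; Λ-T₀ = Λ-T₀′ }
  where open Shifts (shifts k)

-- Comparison with the product over odd parts

-- The parts 3, 1, 7, 5, 11, 9, …, an order in which σ sends each to the next.
ω-odd : ℕ → Weight
ω-odd zero    = ω 3
ω-odd (suc j) = σ (ω-odd j)

odd-product : ℕ → Test → ℕ
odd-product zero    f = f (0 , 0 , 0)
odd-product (suc j) f = odd-product j f + odd-product j (ω-odd j ▷ f)

odd-product-cong : ∀ j {f g : Test} → f ≗ g → odd-product j f ≡ odd-product j g
odd-product-cong zero    e = e _
odd-product-cong (suc j) e =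
  cong₂ _+_ (odd-product-cong j e) (odd-product-cong j (λ p → e (ω-odd j ⊕ p)))

-- The substitution moves every factor to the next one in the order of `ω-odd`, and the factor 1 + a
-- q of `Λ` refills the first place.
Λ-odd-product : ∀ j → Λ (odd-product j) ≗ odd-product (suc j)
Λ-odd-product zero    f = refl
Λ-odd-product (suc j) f = begin
  Λ (odd-product (suc j)) f
    ≡⟨ Λ-+ (odd-product j) (λ g → odd-product j (ω-odd j ▷ g)) f ⟩
  Λ (odd-product j) f + Λ (λ g → odd-product j (ω-odd j ▷ g)) f
    ≡⟨ cong₂ _+_ (Λ-odd-product j f)
         (trans (Λ-▷ (odd-product j) (odd-product-cong j) (ω-odd j) (ω-odd (suc j)) refl f)
                (Λ-odd-product j (ω-odd (suc j) ▷ f))) ⟩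
  odd-product (suc (suc j)) f ∎
  where open ≡-Reasoning

-- Every nonempty chain omitted from T₀ k has a Heavy k weight.
Heavy : ℕ → Weight → Set
Heavy k (u , v , s) = 1 ≤ u + v × k < s

Heavy-⊕ : ∀ {k} w p → Heavy k p → Heavy k (w ⊕ p)
Heavy-⊕ (u′ , v′ , s′) (u , v , s) (1≤u+v , k<s) =
  ≤-trans 1≤u+v (+-mono-≤ (m≤n+m u u′) (m≤n+m v v′)) , ≤-trans k<s (m≤n+m s s′)

Heavy-⊕ʳ : ∀ {k} w p → Heavy k w → Heavy k (w ⊕ p)
Heavy-⊕ʳ {k} w p h = subst (Heavy k) (⊕-comm p w) (Heavy-⊕ p w h)

-- Applying `σ` twice restores u and v and adds u + v to the exponent of q; the condition 1 ≤ u + v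
-- makes this a strict gain.
Heavy-σσ : ∀ {k} p → Heavy k p → Heavy (suc k) (σ (σ p))
Heavy-σσ {k} (u , v , s) (1≤u+v , k<s) =
  1≤u+v , subst (suc (suc k) ≤_) (+-assoc u v s) (+-mono-≤ 1≤u+v k<s)

Light : ℕ → Test → Set
Light k f = ∀ p → Heavy k p → f p ≡ 0

⟦⟧-zero : ∀ L {f : Test} → (∀ p → f p ≡ 0) → ⟦ L ⟧ f ≡ 0
⟦⟧-zero []       e = refl
⟦⟧-zero (xs ∷ L) e = cong₂ _+_ (e (weight xs)) (⟦⟧-zero L e)

Light-· : ∀ L {k f} → Light k f → ∀ r → Heavy 0 (ω r) → 2 ≤ proj₂ (proj₂ (ω r)) →
          ((r + k * 8) · ⟦ L ⟧) f ≡ 0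
Light-· L {k} {f} light r (1≤u+v , _) 2≤s = ⟦⟧-zero L λ p →
  light (ω (r + k * 8) ⊕ p) (Heavy-⊕ʳ (ω (r + k * 8)) p
    (subst (Heavy k) (sym (ω-periodic r k)) (1≤u+v , heavy)))
  where
  heavy : k < k * 2 + proj₂ (proj₂ (ω r))
  heavy = begin-strict
    k                             ≤⟨ m≤m*n k 2 ⟩
    k * 2                         <⟨ m<m+n (k * 2) (<⇒≤ 2≤s) ⟩
    k * 2 + proj₂ (proj₂ (ω r))   ∎
    where open ≤-Reasoning

-- The chains of `T₂ k` outside `T₀ k` begin with 7 + 8k or 5 + 8k, whose weights have q-exponent 2k
-- + 2 > k.
T₂-Light : ∀ k {f} → Light k f → ⟦ T₂ k ⟧ f ≡ ⟦ T₀ k ⟧ f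
T₂-Light k {f} light = begin
  ⟦ T₂ k ⟧ f           ≡⟨ T₂-T₀-eq k f ⟩
  ⟦ T₀ k ⟧ f + ((7 + k * 8) · ⟦ T₂⁻ k ⟧) f + ((5 + k * 8) · ⟦ T₃⁻ k ⟧) f
    ≡⟨ cong₂ (λ a b → ⟦ T₀ k ⟧ f + a + b)
         (Light-· (T₂⁻ k) light 7 (s≤s z≤n , s≤s z≤n) (s≤s (s≤s z≤n)))
         (Light-· (T₃⁻ k) light 5 (s≤s z≤n , s≤s z≤n) (s≤s (s≤s z≤n))) ⟩
  ⟦ T₀ k ⟧ f + 0 + 0   ≡⟨ trans (+-identityʳ _) (+-identityʳ _) ⟩
  ⟦ T₀ k ⟧ f           ∎
  where open ≡-Reasoning

-- By induction: `Λ` applied twice leads from `T₂ k` to `T₀ (suc k)` and adds two factors to the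
-- product, while `T₂-Light` closes the gap between `T₂ k` and `T₀ k`.
T₀-Light : ∀ k {f} → Light k f → ⟦ T₀ k ⟧ f ≡ odd-product (k * 2) f
T₀-Light zero {f} light =
  trans (cong (f (0 , 0 , 0) +_) (cong₂ _+_ (light (1 , 0 , 1) (s≤s z≤n , s≤s z≤n))
          (cong₂ _+_ (light (0 , 1 , 1) (s≤s z≤n , s≤s z≤n))
            (cong (_+ 0) (light (1 , 1 , 2) (s≤s z≤n , s≤s z≤n))))))
        (+-identityʳ _)
T₀-Light (suc k) {f} light = begin
  ⟦ T₀ (suc k) ⟧ f               ≡⟨ Λ-T₃ f ⟨
  Λ ⟦ T₃ k ⟧ f                   ≡⟨ Λ-cong Λ-T₂ f ⟨
  -- Unfolding `Λ` twice leaves four tests, each `f` after `σ ∘ σ` up to a fixed extra weight, so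
  -- `Heavy-σσ` makes each of them `Light k`.
  Λ (Λ ⟦ T₂ k ⟧) f               ≡⟨ cong₂ _+_
      (cong₂ _+_ (truncate λ p h → h)
                 (truncate λ p h → heavy-σ p h))
      (cong₂ _+_ (truncate λ p h → Heavy-⊕ (ω 3) (σ (σ p)) h)
                 (truncate λ p h → Heavy-⊕ (ω 3) (σ (ω 3 ⊕ σ p)) (heavy-σ p h))) ⟩
  Λ (Λ (odd-product (k * 2))) f  ≡⟨ Λ-cong (Λ-odd-product (k * 2)) f ⟩
  Λ (odd-product (suc (k * 2))) f ≡⟨ Λ-odd-product (suc (k * 2)) f ⟩
  odd-product (suc k * 2) f      ∎
  where
  open ≡-Reasoning
  open Shifts (shifts k)
  heavy-σ : ∀ p → Heavy (suc k) (σ (σ p)) → Heavy (suc k) (σ (ω 3 ⊕ σ p))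
  heavy-σ p h =
    subst (Heavy (suc k)) (sym (σ-⊕ (ω 3) (σ p))) (Heavy-⊕ (σ (ω 3)) (σ (σ p)) h)
  truncate : ∀ {α : Weight → Weight} →
             (∀ p → Heavy (suc k) (σ (σ p)) → Heavy (suc k) (α p)) →
             ⟦ T₂ k ⟧ (f ∘ α) ≡ odd-product (k * 2) (f ∘ α)
  truncate {α} heavy = trans (T₂-Light k light′) (T₀-Light k light′)
    where
    light′ : Light k (f ∘ α)
    light′ p h = light (α p) (heavy p (Heavy-σσ p h))

-- Enumeration of chains

-- The common frame for both kinds of partition: y may follow x exactly when `rank y ≤ cap x`, so
-- the possible tails depend on x through one number only.
module Chains (Part : ℕ → Set) (rank cap : ℕ → ℕ) where

  infixr 5 _∷⟨_⟩_
  data Chain (ℓ : ℕ) : List ℕ → Set where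
    []     : Chain ℓ []
    _∷⟨_⟩_ : ∀ {x xs} → Part x → rank x ≤ ℓ → Chain (cap x) xs → Chain ℓ (x ∷ xs)

  weaken : ∀ {ℓ m xs} → ℓ ≤ m → Chain ℓ xs → Chain m xs
  weaken ℓ≤m []             = []
  weaken ℓ≤m (p ∷⟨ r ⟩ ch)  = p ∷⟨ ≤-trans r ℓ≤m ⟩ ch

  Chain⇒All : ∀ {ℓ xs} → Chain ℓ xs → All Part xs
  Chain⇒All []             = []
  Chain⇒All (p ∷⟨ _ ⟩ ch)  = p ∷ Chain⇒All ch

  module _ {R : Rel ℕ 0ℓ} (R⇔ : ∀ {x y} → Part x → Part y → R x y ⇔ rank y ≤ cap x) where

    Chain⇒Linked : ∀ {ℓ xs} → Chain ℓ xs → Linked R xs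
    Chain⇒Linked []                            = []
    Chain⇒Linked (p ∷⟨ _ ⟩ [])                 = [-]
    Chain⇒Linked (p ∷⟨ _ ⟩ ch@(q ∷⟨ r ⟩ _))    =
      Equivalence.from (R⇔ p q) r ∷ Chain⇒Linked ch

    Linked⇒Chain : ∀ {ℓ x xs} → All Part (x ∷ xs) → Linked R (x ∷ xs) → rank x ≤ ℓ → Chain ℓ (x ∷ xs)
    Linked⇒Chain (p ∷ _)          [-]      r = p ∷⟨ r ⟩ []
    Linked⇒Chain (p ∷ ps@(q ∷ _)) (s ∷ ss) r =
      p ∷⟨ r ⟩ Linked⇒Chain ps ss (Equivalence.to (R⇔ p q) s)

  record Enumerates (ℓ : ℕ) (L : List (List ℕ)) : Set where
    field
      unique   : Unique L
      sound    : ∀ {xs} → xs ∈ L → Chain ℓ xs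
      complete : ∀ {xs} → Chain ℓ xs → xs ∈ L
  open Enumerates public

  Enumerates-[[]] : ∀ {ℓ} → (∀ {x} → Part x → ℓ < rank x) → Enumerates ℓ ([] ∷ [])
  Enumerates-[[]] none = record
    { unique   = [] ∷ []
    ; sound    = λ { (here refl) → [] }
    ; complete = λ { [] → here refl ; (p ∷⟨ r ⟩ _) → contradiction r (<⇒≱ (none p)) }
    }

  Block : ℕ → ℕ × List (List ℕ) → Set
  Block ℓ (x , L) = Part x × rank x ≡ ℓ × Enumerates (cap x) L

  ∈-prepend⁻ : ∀ ps {xs} → xs ∈ prepend ps →
               ∃ λ x → ∃ λ L → ∃ λ ys → (x , L) ∈ ps × ys ∈ L × xs ≡ x ∷ ys
  ∈-prepend⁻ ((x , L) ∷ ps) xs∈ with ∈-++⁻ (map (x ∷_) L) xs∈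
  ... | inj₁ q = let ys , ys∈ , e = ∈-map⁻ (x ∷_) q in x , L , ys , here refl , ys∈ , e
  ... | inj₂ q = let y , M , ys , p , ys∈ , e = ∈-prepend⁻ ps q in y , M , ys , there p , ys∈ , e

  prepend-unique : ∀ {ℓ ps} → Unique (map proj₁ ps) → All (Block ℓ) ps → Unique (prepend ps)
  prepend-unique {ps = []}           _        _        = []
  prepend-unique {ps = (x , L) ∷ ps} (d ∷ ds) ((_ , _ , e) ∷ bs) =
    ++⁺ (map⁺ ∷-injectiveʳ (unique e)) (prepend-unique ds bs) disjoint
    where
    disjoint : ∀ {xs} → xs ∈ map (x ∷_) L × xs ∈ prepend ps → ⊥
    disjoint (p , q) with ∈-map⁻ (x ∷_) p | ∈-prepend⁻ ps q
    ... | _ , _ , refl | _ , _ , _ , x∈ , _ , refl = All¬⇒¬Any d (∈-map⁺ proj₁ x∈)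

  ∈-prepend⁺ : ∀ {ℓ ps x xs} → All (Block ℓ) ps → x ∈ map proj₁ ps → Chain (cap x) xs →
               (x ∷ xs) ∈ prepend ps
  ∈-prepend⁺ ((_ , _ , e) ∷ _) (here refl) ch = ∈-++⁺ˡ (∈-map⁺ _ (complete e ch))
  ∈-prepend⁺ (_ ∷ bs)          (there x∈)  ch = ∈-++⁺ʳ _ (∈-prepend⁺ bs x∈ ch)

  -- A chain of bound `suc ℓ` either has bound ℓ already or is led by a part of rank exactly
  -- `suc ℓ`; comparing the leading ranks shows that the two kinds are disjoint.
  Enumerates-suc : ∀ {ℓ L} ps → Enumerates ℓ L → Unique (map proj₁ ps) →
                   All (Block (suc ℓ)) ps →
                   (∀ {x} → Part x → rank x ≡ suc ℓ → x ∈ map proj₁ ps) →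
                   Enumerates (suc ℓ) (L ++ prepend ps)
  Enumerates-suc {ℓ} {L} ps en uq bs exhaustive = record
    { unique   = ++⁺ (unique en) (prepend-unique uq bs) disjoint
    ; sound    = sound′
    ; complete = complete′
    }
    where
    disjoint : ∀ {xs} → xs ∈ L × xs ∈ prepend ps → ⊥
    disjoint (p , q) with ∈-prepend⁻ ps q
    ... | x , _ , _ , x∈ , _ , refl with sound en p | All.lookup bs x∈
    ...   | _ ∷⟨ r ⟩ _ | _ , e , _ = <-irrefl refl (subst (_≤ ℓ) e r)

    sound′ : ∀ {xs} → xs ∈ L ++ prepend ps → Chain (suc ℓ) xs
    sound′ xs∈ with ∈-++⁻ L xs∈
    ... | inj₁ p = weaken (n≤1+n ℓ) (sound en p)
    ... | inj₂ q with ∈-prepend⁻ ps q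
    ...   | _ , _ , _ , x∈ , ys∈ , refl with All.lookup bs x∈
    ...     | p , e , en′ = p ∷⟨ ≤-reflexive e ⟩ sound en′ ys∈

    complete′ : ∀ {xs} → Chain (suc ℓ) xs → xs ∈ L ++ prepend ps
    complete′ []             = ∈-++⁺ˡ (complete en [])
    complete′ (p ∷⟨ r ⟩ ch) with m≤n⇒m<n∨m≡n r
    ... | inj₁ (s≤s r′) = ∈-++⁺ˡ (complete en (p ∷⟨ r′ ⟩ ch))
    ... | inj₂ e        = ∈-++⁺ʳ L (∈-prepend⁺ bs (exhaustive p e) ch)

-- The gap conditions as rank inequalities

-- The parts that may follow x form an initial segment of the preorder
-- 3 < 1, 4 < 7 < 5 < 8, 10, 11 < 6, 9, 12 < 15 < 13 < ⋯ (see GapOK⇔rank). The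
-- offset 6 makes both functions periodic without truncation at 0.
rank cap : ℕ → ℕ
rank 0 = 6
rank 1 = 7
rank 2 = 6
rank 3 = 6
rank 4 = 7
rank 5 = 9
rank 6 = 11
rank 7 = 8
rank (suc (suc (suc (suc (suc (suc (suc (suc x)))))))) = 4 + rank x

cap 0 = 2
cap 1 = 4
cap 2 = 1
cap 3 = 3
cap 4 = 5
cap 5 = 6
cap 6 = 6
cap 7 = 5
cap (suc (suc (suc (suc (suc (suc (suc (suc x)))))))) = 4 + cap x

rank-periodic : ∀ r k → rank (r + k * 8) ≡ rank r + k * 4
rank-periodic r k = trans (cong rank (+-comm r (k * 8))) (trans (go k) (+-comm (k * 4) (rank r)))
  where
  go : ∀ k → rank (k * 8 + r) ≡ k * 4 + rank r
  go zero    = refl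
  go (suc k) = cong (4 +_) (go k)

cap-periodic : ∀ r k → cap (r + k * 8) ≡ cap r + k * 4
cap-periodic r k = trans (cong cap (+-comm r (k * 8))) (trans (go k) (+-comm (k * 4) (cap r)))
  where
  go : ∀ k → cap (k * 8 + r) ≡ k * 4 + cap r
  go zero    = refl
  go (suc k) = cong (4 +_) (go k)

below : ∀ n (P : ℕ → Set) → (∀ (i : Fin n) → P (toℕ i)) → ∀ {x} → x < n → P x
below n P all x<n = subst P (toℕ-fromℕ< x<n) (all (fromℕ< x<n))

module _ (n : ℕ) (P : ℕ → Set) where
  below-or-above : (∀ (i : Fin n) → P (toℕ i)) → (∀ x → P (n + x)) → ∀ x → P x
  below-or-above small large x with x <? n
  ... | yes x<n = below n P small x<n
  ... | no x≮n  = subst P (m+[n∸m]≡n (≮⇒≥ x≮n)) (large (x ∸ n))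

periodic-induction : (P : ℕ → Set) → (∀ (i : Fin 8) → P (toℕ i)) → (∀ x → P x → P (8 + x)) →
                     ∀ x → P x
periodic-induction P base step = <-rec P λ x rec →
  below-or-above 8 (λ x → (∀ {y} → y < x → P y) → P x)
    (λ i _ → base i) (λ x rec → step x (rec (m<n+m x (s≤s z≤n)))) x rec

rank≥6 : ∀ x → 6 ≤ rank x
rank≥6 = periodic-induction (λ x → 6 ≤ rank x) (from-yes (all? {n = 8} λ i → 6 ≤? rank (toℕ i)))
  (λ x h → ≤-trans h (m≤n+m (rank x) 4))

rank-bound : ∀ x → rank x ≤ x + 7
rank-bound = periodic-induction (λ x → rank x ≤ x + 7)
  (from-yes (all? {n = 8} λ i → rank (toℕ i) ≤? toℕ i + 7))
  (λ x h → ≤-trans (+-monoʳ-≤ 4 h) (m≤n+m (4 + (x + 7)) 4))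

-- Raising x by 8 raises the rank by 4, so the fibre over ℓ + 4k is that over ℓ shifted by 8k. For ℓ
-- ≤ 11 the latter lies below 16, since from 16 on the ranks are at least 14.
rank-inverse : ∀ ℓ rs {_ : True (8 ≤? ℓ)} {_ : True (ℓ ≤? 11)}
               {_ : True (all? {n = 16} λ i → (rank (toℕ i) ≟ ℓ) →-dec (toℕ i ∈? rs))} →
               ∀ k x → rank x ≡ ℓ + k * 4 → x ∈ map (λ r → r + k * 8) rs
rank-inverse ℓ rs {8≤ℓ} {ℓ≤11} {small} k x e =
  let r , r∈ , x≡ = find k x e in
  subst (_∈ map (λ r → r + k * 8) rs) (sym x≡) (∈-map⁺ (λ r → r + k * 8) r∈)
  where
  find₀ : ∀ x → rank x ≡ ℓ → x ∈ rs
  find₀ = below-or-above 16 (λ x → rank x ≡ ℓ → x ∈ rs) (toWitness small) λ x e →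
    contradiction (≤-trans (+-monoʳ-≤ 8 (rank≥6 x)) (≤-trans (≤-reflexive e) (toWitness ℓ≤11)))
                  (from-no (14 ≤? 11))
  find : ∀ k x → rank x ≡ ℓ + k * 4 → ∃ λ r → r ∈ rs × x ≡ r + k * 8
  find zero    x e = x , find₀ x (trans e (+-identityʳ ℓ)) , sym (+-identityʳ x)
  find (suc k) = below-or-above 8 _
    -- No x < 8 can occur: its rank is at most 11, whereas ℓ + 4 (k + 1) is at least 12.
    (λ i e → contradiction
      (≤-trans (m≤m+n 12 (k * 4)) (≤-trans (+-monoˡ-≤ (4 + k * 4) (toWitness 8≤ℓ))
        (≤-trans (≤-reflexive (sym e)) (below-11 i))))
      (from-no (12 ≤? 11)))
    (λ x e → let r , r∈ , x≡ = find k x (+-cancelˡ-≡ 4 _ _ (trans e (shift 4 (k * 4))))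
             in r , r∈ , trans (cong (8 +_) x≡) (sym (shift′ r 8 (k * 8))))
    where
    below-11 : ∀ (i : Fin 8) → rank (toℕ i) ≤ 11
    below-11 = from-yes (all? {n = 8} λ i → rank (toℕ i) ≤? 11)
    shift′ : ∀ a b c → a + (b + c) ≡ b + (a + c)
    shift′ = solve-∀
    shift : ∀ b c → ℓ + (b + c) ≡ b + (ℓ + c)
    shift = shift′ ℓ

¬AllowedGap-0 : ∀ r → ¬ AllowedGap r 0
¬AllowedGap-0 = from-yes (all? λ r → ¬? (allowedGap? r 0))

AllowedGap-≥13 : ∀ r {d} → 13 ≤ d → AllowedGap r d
AllowedGap-≥13 0F h = inj₂ (≤-trans (m≤n+m _ 2) h)
AllowedGap-≥13 1F h = inj₂ (≤-trans (m≤n+m _ 8) h)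
AllowedGap-≥13 2F h = inj₂ h
AllowedGap-≥13 3F h = ≤-trans (m≤n+m _ 6) h
AllowedGap-≥13 4F h = inj₂ (≤-trans (m≤n+m _ 6) h)
AllowedGap-≥13 5F h = inj₂ (≤-trans (m≤n+m _ 5) h)
AllowedGap-≥13 6F h = inj₂ (≤-trans (m≤n+m _ 4) h)
AllowedGap-≥13 7F h = inj₂ (≤-trans (m≤n+m _ 3) h)

-- For x ≤ y the truncated difference is 0, a gap that no residue allows.
GapOK⇒> : ∀ {x y} → GapOK x y → x > y
GapOK⇒> {x} {y} g = ≰⇒> λ x≤y →
  ¬AllowedGap-0 (x mod 8) (subst (AllowedGap (x mod 8)) (m≤n⇒m∸n≡0 x≤y) g)

-- Raising x and y by 8 keeps the gap and the residue and adds 4 to both sides of the inequality, so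
-- one of the two may be taken below 8. If x < 8 ≤ y, both sides fail.
GapOK⇔rank : ∀ x y → GapOK x y ⇔ rank y ≤ cap x
GapOK⇔rank = periodic-induction (λ x → ∀ y → GapOK x y ⇔ rank y ≤ cap x)
  (λ i → below-or-above 8 _ (λ j → y<8 j (toℕ i)) (λ y → mk⇔
    (λ g → contradiction (GapOK⇒> {toℕ i} {8 + y} g) (≤⇒≯ (≤-trans (<⇒≤ (toℕ<n i)) (m≤m+n 8 y))))
    (λ r → contradiction (≤-trans (+-monoʳ-≤ 4 (rank≥6 y)) (≤-trans r (cap≤6 i)))
                         (from-no (10 ≤? 6)))))
  (λ x ih → below-or-above 8 _ (λ j → y<8 j (8 + x)) (λ y → mk⇔
    (λ g → +-monoʳ-≤ 4 (Equivalence.to (ih y) g))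
    (λ r → Equivalence.from (ih y) (+-cancelˡ-≤ 4 _ _ r))))
  where
  cap≤6 : ∀ (i : Fin 8) → cap (toℕ i) ≤ 6
  cap≤6 = from-yes (all? {n = 8} λ i → cap (toℕ i) ≤? 6)
  rank≤12 : ∀ (j : Fin 8) → rank (toℕ j) ≤ 12
  rank≤12 = from-yes (all? {n = 8} λ j → rank (toℕ j) ≤? 12)
  -- From x = 24 on, the gap is at least 13, which every residue allows, and `cap x` is at least 12,
  -- so both sides hold. What remains is a finite table.
  y<8 : ∀ (j : Fin 8) x → GapOK x (toℕ j) ⇔ rank (toℕ j) ≤ cap x
  y<8 j = below-or-above 24 _
    (λ i → let to , from = small i j in mk⇔ to from)
    (λ x → mk⇔
      (λ _ → ≤-trans (rank≤12 j) (m≤m+n 12 (cap x)))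
      (λ _ → AllowedGap-≥13 ((24 + x) mod 8)
        (m+n≤o⇒m≤o∸n 13 (≤-trans (+-monoʳ-≤ 13 (<⇒≤ (toℕ<n j))) (m≤m+n 21 (3 + x))))))
    where
    small : ∀ (i : Fin 24) (j : Fin 8) →
            (GapOK (toℕ i) (toℕ j) → rank (toℕ j) ≤ cap (toℕ i)) ×
            (rank (toℕ j) ≤ cap (toℕ i) → GapOK (toℕ i) (toℕ j))
    small = from-yes (all? {n = 24} λ i → all? {n = 8} λ j →
      let g? = allowedGap? (toℕ i mod 8) (toℕ i ∸ toℕ j)
          r? = rank (toℕ j) ≤? cap (toℕ i)
      in (g? →-dec r?) ×-dec (r? →-dec g?))

D-Part : ℕ → Set
D-Part x = x > 0 × x ≢ 2

module D = Chains D-Part rank cap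

D-part? : ∀ x → Dec (D-Part x)
D-part? x = (x >? 0) ×-dec ¬? (x ≟ 2)

block : ∀ r k {L} → D-Part (r + k * 8) → D.Enumerates (cap r + k * 4) L →
        D.Block (rank r + k * 4) (r + k * 8 , L)
block r k {L} part en =
  part , rank-periodic r k , subst (λ ℓ → D.Enumerates ℓ L) (sym (cap-periodic r k)) en

unique-shift : ∀ k {rs} → Unique rs → Unique (map (λ r → r + k * 8) rs)
unique-shift k = map⁺ (λ {r} {r′} → +-cancelʳ-≡ (k * 8) r r′)

-- Each list adds to its predecessor the parts of one new rank. The `cap` of such a part is the
-- bound of an earlier list, and that list supplies the tails.
enum-T₀ : ∀ k → D.Enumerates (7 + k * 4) (T₀ k)
enum-T₁ : ∀ k → D.Enumerates (8 + k * 4) (T₁ k)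
enum-T₂ : ∀ k → D.Enumerates (9 + k * 4) (T₂ k)
enum-T₃ : ∀ k → D.Enumerates (10 + k * 4) (T₃ k)
enum-T₂⁻ : ∀ k → D.Enumerates (5 + k * 4) (T₂⁻ k)
enum-T₃⁻ : ∀ k → D.Enumerates (6 + k * 4) (T₃⁻ k)

enum-T₂⁻ zero    = D.Enumerates-[[]] λ {x} _ → rank≥6 x
enum-T₂⁻ (suc k) = enum-T₂ k

-- The numbers of rank 6 are 0, 2 and 3; `D-Part` leaves only 3.
enum-T₃⁻ zero = D.Enumerates-suc _ (enum-T₂⁻ 0) ([] ∷ [])
  ((((s≤s z≤n) , λ ()) , refl , D.Enumerates-[[]] λ {x} _ → ≤-trans (m≤n+m 4 2) (rank≥6 x)) ∷ [])
  (λ {x} → below-or-above 8 (λ x → D-Part x → rank x ≡ 6 → x ∈ 3 ∷ [])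
    (from-yes (all? {n = 8} λ i → D-part? (toℕ i) →-dec ((rank (toℕ i) ≟ 6) →-dec (toℕ i ∈? 3 ∷ []))))
    (λ x _ e → contradiction (≤-trans (+-monoʳ-≤ 4 (rank≥6 x)) (≤-reflexive e)) (from-no (10 ≤? 6))) x)
enum-T₃⁻ (suc k) = enum-T₃ k

-- Continued downwards, the pattern 6, 9, 12 gives -2, 1, 4, so only two parts have rank 7.
enum-T₀ zero = D.Enumerates-suc _ (enum-T₃⁻ 0) (from-yes (unique? (1 ∷ 4 ∷ [])))
  (((s≤s z≤n , λ ()) , refl , D.Enumerates-[[]] λ {x} _ → ≤-trans (m≤n+m 5 1) (rank≥6 x))
   ∷ ((s≤s z≤n , λ ()) , refl , enum-T₂⁻ 0) ∷ [])
  (λ {x} → below-or-above 8 (λ x → D-Part x → rank x ≡ 7 → x ∈ 1 ∷ 4 ∷ [])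
    (from-yes (all? {n = 8} λ i → D-part? (toℕ i) →-dec ((rank (toℕ i) ≟ 7) →-dec (toℕ i ∈? 1 ∷ 4 ∷ []))))
    (λ x _ e → contradiction (≤-trans (+-monoʳ-≤ 4 (rank≥6 x)) (≤-reflexive e)) (from-no (10 ≤? 7))) x)
enum-T₀ (suc k) = D.Enumerates-suc _ (enum-T₃ k)
  (unique-shift k (from-yes (unique? (6 ∷ 9 ∷ 12 ∷ []))))
  (block 6 k (s≤s z≤n , λ ()) (enum-T₃⁻ k) ∷ block 9 k (s≤s z≤n , λ ()) (enum-T₁ k)
   ∷ block 12 k (s≤s z≤n , λ ()) (enum-T₂ k) ∷ [])
  (λ {x} _ → rank-inverse 11 (6 ∷ 9 ∷ 12 ∷ []) k x)

enum-T₁ k = D.Enumerates-suc _ (enum-T₀ k) ([] ∷ [])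
  (block 7 k (s≤s z≤n , λ ()) (enum-T₂⁻ k) ∷ [])
  (λ {x} _ → rank-inverse 8 (7 ∷ []) k x)

enum-T₂ k = D.Enumerates-suc _ (enum-T₁ k) ([] ∷ [])
  (block 5 k (s≤s z≤n , λ ()) (enum-T₃⁻ k) ∷ [])
  (λ {x} _ → rank-inverse 9 (5 ∷ []) k x)

enum-T₃ k = D.Enumerates-suc _ (enum-T₂ k)
  (unique-shift k (from-yes (unique? (8 ∷ 10 ∷ 11 ∷ []))))
  (block 8 k (s≤s z≤n , λ ()) (enum-T₃⁻ k) ∷ block 10 k (s≤s z≤n , λ ()) (enum-T₂⁻ k)
   ∷ block 11 k (s≤s z≤n , λ ()) (enum-T₀ k) ∷ [])
  (λ {x} _ → rank-inverse 10 (8 ∷ 10 ∷ 11 ∷ []) k x)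

-- Counting partitions

-- Lists without repetitions that have the same members are permutations of each other.
count-⇔ : ∀ {A : Set} {P Q : Pred A 0ℓ} (P? : Decidable P) (Q? : Decidable Q) {xs ys} →
          Unique xs → Unique ys → (∀ z → (z ∈ xs × P z) ⇔ (z ∈ ys × Q z)) →
          count P? xs ≡ count Q? ys
count-⇔ P? Q? {xs} {ys} uxs uys e = ↭-length (∼bag⇒↭ (unique∧set⇒bag
  (filter⁺ P? uxs) (filter⁺ Q? uys) λ {z} → mk⇔
    (λ z∈ → let p , q = Equivalence.to (e z) (∈-filter⁻ P? {xs = xs} z∈) in ∈-filter⁺ Q? p q)
    (λ z∈ → let p , q = Equivalence.from (e z) (∈-filter⁻ Q? {xs = ys} z∈) in ∈-filter⁺ P? p q)))

χ : ∀ {P : Set} → Dec P → ℕ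
χ P? = if does P? then 1 else 0

count-∷ : ∀ {A : Set} {P : Pred A 0ℓ} (P? : Decidable P) x xs →
          count P? (x ∷ xs) ≡ χ (P? x) + count P? xs
count-∷ P? x xs with P? x
... | yes _ = refl
... | no _  = refl

count-sum : ∀ {A : Set} {P : Pred A 0ℓ} (P? : Decidable P) xs →
            count P? xs ≡ sum (map (χ ∘ P?) xs)
count-sum P? []       = refl
count-sum P? (x ∷ xs) = trans (count-∷ P? x xs) (cong (χ (P? x) +_) (count-sum P? xs))

wᵤ wᵥ wₛ : Weight → ℕ
wᵤ (u , _ , _) = u
wᵥ (_ , v , _) = v
wₛ (_ , _ , s) = s

module _ {P Q : Pred ℕ 0ℓ} (P? : Decidable P) (Q? : Decidable Q) where
  count-additive : (w : Weight → ℕ) → (∀ p q → w (p ⊕ q) ≡ w p + w q) → w (0 , 0 , 0) ≡ 0 →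
                   (∀ x → χ (P? x) + 2 * χ (Q? x) ≡ w (ω x)) →
                   ∀ xs → count P? xs + 2 * count Q? xs ≡ w (weight xs)
  count-additive w w-⊕ w-0 w-ω []       = sym w-0
  count-additive w w-⊕ w-0 w-ω (x ∷ xs) = begin
    count P? (x ∷ xs) + 2 * count Q? (x ∷ xs)
      ≡⟨ cong₂ (λ a b → a + 2 * b) (count-∷ P? x xs) (count-∷ Q? x xs) ⟩
    χ (P? x) + count P? xs + 2 * (χ (Q? x) + count Q? xs)
      ≡⟨ rearrange (χ (P? x)) (count P? xs) (χ (Q? x)) (count Q? xs) ⟩
    (χ (P? x) + 2 * χ (Q? x)) + (count P? xs + 2 * count Q? xs)
      ≡⟨ cong₂ _+_ (w-ω x) (count-additive w w-⊕ w-0 w-ω xs) ⟩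
    w (ω x) + w (weight xs)
      ≡⟨ w-⊕ (ω x) (weight xs) ⟨
    w (weight (x ∷ xs)) ∎
    where
    open ≡-Reasoning
    rearrange : ∀ a b c d → a + b + 2 * (c + d) ≡ a + 2 * c + (b + 2 * d)
    rearrange = solve-∀

periodic-≗ : ∀ (f g : ℕ → ℕ) {_ : True (all? {n = 8} λ i → f (toℕ i) ≟ g (toℕ i))} →
             (∀ x → f x ≡ g x → f (8 + x) ≡ g (8 + x)) → f ≗ g
periodic-≗ f g {base} = periodic-induction (λ x → f x ≡ g x) (toWitness base)

uWeight-weight : ∀ xs → uWeight xs ≡ wᵤ (weight xs)
uWeight-weight = count-additive _ _ wᵤ (λ _ _ → refl) refl
  (periodic-≗ (λ x → χ ((x % 4 ≟ 0) ⊎-dec (x % 4 ≟ 3)) + 2 * χ (x % 8 ≟ 2)) (wᵤ ∘ ω)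
    (λ _ e → e))

vWeight-weight : ∀ xs → vWeight xs ≡ wᵥ (weight xs)
vWeight-weight = count-additive _ _ wᵥ (λ _ _ → refl) refl
  (periodic-≗ (λ x → χ ((x % 4 ≟ 0) ⊎-dec (x % 4 ≟ 1)) + 2 * χ (x % 8 ≟ 6)) (wᵥ ∘ ω)
    (λ _ e → e))

-- The formula defining the third component of `ω` is linear in the part and its two counts, so it
-- passes to sums. Hence the weight determines the size of the partition.
dilation : ∀ xs → 4 * wₛ (weight xs) ≡ sum xs + wᵤ (weight xs) + 3 * wᵥ (weight xs)
dilation []       = refl
dilation (x ∷ xs) = begin
  4 * (wₛ (ω x) + wₛ w)
    ≡⟨ *-distribˡ-+ 4 (wₛ (ω x)) (wₛ w) ⟩
  4 * wₛ (ω x) + 4 * wₛ w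
    ≡⟨ cong₂ _+_ (part x) (dilation xs) ⟩
  x + wᵤ (ω x) + 3 * wᵥ (ω x) + (sum xs + wᵤ w + 3 * wᵥ w)
    ≡⟨ rearrange x (wᵤ (ω x)) (wᵥ (ω x)) (sum xs) (wᵤ w) (wᵥ w) ⟩
  x + sum xs + (wᵤ (ω x) + wᵤ w) + 3 * (wᵥ (ω x) + wᵥ w) ∎
  where
  open ≡-Reasoning
  w : Weight
  w = weight xs
  rearrange : ∀ a b c d e g →
    a + b + 3 * c + (d + e + 3 * g) ≡ a + d + (b + e) + 3 * (c + g)
  rearrange = solve-∀
  part : ∀ x → 4 * wₛ (ω x) ≡ x + wᵤ (ω x) + 3 * wᵥ (ω x)
  part = periodic-≗ (λ x → 4 * wₛ (ω x)) (λ x → x + wᵤ (ω x) + 3 * wᵥ (ω x))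
    (λ x e → trans (*-distribˡ-+ 4 2 (wₛ (ω x))) (cong (8 +_) e))

-- Partitions into distinct odd parts

C-Part : ℕ → Set
C-Part x = x % 4 ≡ 3 ⊎ x % 4 ≡ 1

C-part? : Decidable C-Part
C-part? x = (x % 4 ≟ 3) ⊎-dec (x % 4 ≟ 1)

-- For odd numbers, x > y means that the half of y, rounded down, is less than that of x; the `suc`
-- in the rank makes this strict inequality a weak one.
module C = Chains C-Part (λ x → suc ⌊ x /2⌋) ⌊_/2⌋

C-count : (w : Weight → ℕ) → (∀ p q → w (p ⊕ q) ≡ w p + w q) → w (0 , 0 , 0) ≡ 0 →
          ∀ {P : Pred ℕ 0ℓ} (P? : Decidable P) → (∀ x → C-Part x → χ (P? x) ≡ w (ω x)) →
          ∀ {xs} → All C-Part xs → count P? xs ≡ w (weight xs)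
C-count w w-⊕ w-0 P? w-ω []                = sym w-0
C-count w w-⊕ w-0 P? w-ω (_∷_ {x} {xs} p ps) = begin
  count P? (x ∷ xs)          ≡⟨ count-∷ P? x xs ⟩
  χ (P? x) + count P? xs     ≡⟨ cong₂ _+_ (w-ω x p) (C-count w w-⊕ w-0 P? w-ω ps) ⟩
  w (ω x) + w (weight xs)    ≡⟨ w-⊕ (ω x) (weight xs) ⟨
  w (weight (x ∷ xs))        ∎
  where open ≡-Reasoning

C-count₃ : ∀ {xs} → All C-Part xs → count (λ x → x % 4 ≟ 3) xs ≡ wᵤ (weight xs)
C-count₃ = C-count wᵤ (λ _ _ → refl) refl (λ x → x % 4 ≟ 3)
  (periodic-induction (λ x → C-Part x → χ (x % 4 ≟ 3) ≡ wᵤ (ω x))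
    (from-yes (all? {n = 8} λ i → C-part? (toℕ i) →-dec (χ (toℕ i % 4 ≟ 3) ≟ wᵤ (ω (toℕ i))))) (λ _ e → e))

C-count₁ : ∀ {xs} → All C-Part xs → count (λ x → x % 4 ≟ 1) xs ≡ wᵥ (weight xs)
C-count₁ = C-count wᵥ (λ _ _ → refl) refl (λ x → x % 4 ≟ 1)
  (periodic-induction (λ x → C-Part x → χ (x % 4 ≟ 1) ≡ wᵥ (ω x))
    (from-yes (all? {n = 8} λ i → C-part? (toℕ i) →-dec (χ (toℕ i % 4 ≟ 1) ≟ wᵥ (ω (toℕ i))))) (λ _ e → e))

C-Part⇒odd : ∀ x → C-Part x → x ≡ 1 + ⌊ x /2⌋ * 2
C-Part⇒odd = periodic-induction (λ x → C-Part x → x ≡ 1 + ⌊ x /2⌋ * 2)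
  (from-yes (all? {n = 8} λ i → C-part? (toℕ i) →-dec (toℕ i ≟ 1 + ⌊ toℕ i /2⌋ * 2)))
  (λ x e p → cong (8 +_) (e p))

odd⇒C-Part : ∀ j → C-Part (1 + j * 2)
odd⇒C-Part 0             = inj₂ refl
odd⇒C-Part 1             = inj₁ refl
odd⇒C-Part (suc (suc j)) = odd⇒C-Part j

⌊odd/2⌋ : ∀ j → ⌊ 1 + j * 2 /2⌋ ≡ j
⌊odd/2⌋ zero    = refl
⌊odd/2⌋ (suc j) = cong suc (⌊odd/2⌋ j)

>⇔half : ∀ {x y} → C-Part x → C-Part y → x > y ⇔ suc ⌊ y /2⌋ ≤ ⌊ x /2⌋
>⇔half {x} {y} p q = mk⇔
  (λ y<x → *-cancelʳ-< 2 ⌊ y /2⌋ ⌊ x /2⌋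
    (+-cancelˡ-< 1 _ _ (subst₂ _<_ (C-Part⇒odd y q) (C-Part⇒odd x p) y<x)))
  (λ h → subst₂ _<_ (sym (C-Part⇒odd y q)) (sym (C-Part⇒odd x p)) (+-monoʳ-< 1 (*-monoˡ-< 2 h)))

odd-lists : ℕ → List (List ℕ)
odd-lists zero    = [] ∷ []
odd-lists (suc j) = odd-lists j ++ prepend ((1 + j * 2 , odd-lists j) ∷ [])

enum-odd-lists : ∀ j → C.Enumerates j (odd-lists j)
enum-odd-lists zero    = C.Enumerates-[[]] λ _ → s≤s z≤n
enum-odd-lists (suc j) = C.Enumerates-suc _ (enum-odd-lists j) ([] ∷ [])
  ((odd⇒C-Part j , cong suc (⌊odd/2⌋ j) ,
    subst (λ ℓ → C.Enumerates ℓ (odd-lists j)) (sym (⌊odd/2⌋ j)) (enum-odd-lists j)) ∷ [])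
  (λ {x} p e → here
    (trans (C-Part⇒odd x p) (cong (λ i → 1 + i * 2) (suc-injective e))))

-- Raising an odd part by 4 adds one factor q, and so does `σ ∘ σ` when u + v = 1.
ω₃ : ∀ k → ω (3 + k * 2 * 2) ≡ ω-odd (k * 2)
ω₃ k = trans (go k) (sym (go′ k))
  where
  go : ∀ k → ω (3 + k * 2 * 2) ≡ (1 , 0 , suc k)
  go 0 = refl
  go 1 = refl
  go (suc (suc k)) = cong ((0 , 0 , 2) ⊕_) (go k)
  go′ : ∀ k → ω-odd (k * 2) ≡ (1 , 0 , suc k)
  go′ zero    = refl
  go′ (suc k) = cong (σ ∘ σ) (go′ k)

ω₁ : ∀ k → ω (1 + k * 2 * 2) ≡ ω-odd (1 + k * 2)
ω₁ k = trans (go k) (sym (go′ k))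
  where
  go : ∀ k → ω (1 + k * 2 * 2) ≡ (0 , 1 , suc k)
  go 0 = refl
  go 1 = refl
  go (suc (suc k)) = cong ((0 , 0 , 2) ⊕_) (go k)
  go′ : ∀ k → ω-odd (1 + k * 2) ≡ (0 , 1 , suc k)
  go′ zero    = refl
  go′ (suc k) = cong (σ ∘ σ) (go′ k)

-- The lists take 1 + 4k before 3 + 4k, the product takes them in the opposite order; adding two
-- factors at a time reconciles the orders.
odd-lists-product : ∀ k → ⟦ odd-lists (k * 2) ⟧ ≗ odd-product (k * 2)
odd-lists-product zero    f = +-identityʳ _
odd-lists-product (suc k) f = begin
  ⟦ odd-lists (2 + j) ⟧ f
    ≡⟨ ⟦⟧-++-prepend₁ (odd-lists (1 + j)) (3 + j * 2) (odd-lists (1 + j)) f ⟩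
  ⟦ odd-lists (1 + j) ⟧ f + ⟦ odd-lists (1 + j) ⟧ (ω (3 + j * 2) ▷ f)
    ≡⟨ cong₂ _+_ (expand f) (expand (ω (3 + j * 2) ▷ f)) ⟩
  odd-product j f + odd-product j (ω (1 + j * 2) ▷ f)
    + (odd-product j (ω (3 + j * 2) ▷ f) + odd-product j (ω (1 + j * 2) ▷ ω (3 + j * 2) ▷ f))
    ≡⟨ cong₂ (λ a b → odd-product j f + odd-product j (b ▷ f)
               + (odd-product j (a ▷ f) + odd-product j (b ▷ a ▷ f))) (ω₃ k) (ω₁ k) ⟩
  odd-product j f + odd-product j (β ▷ f)
    + (odd-product j (α ▷ f) + odd-product j (β ▷ α ▷ f))
    ≡⟨ interchange (odd-product j f) _ _ _ ⟩
  odd-product j f + odd-product j (α ▷ f)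
    + (odd-product j (β ▷ f) + odd-product j (β ▷ α ▷ f))
    ≡⟨ cong (λ t → odd-product j f + odd-product j (α ▷ f) + (odd-product j (β ▷ f) + t))
         (odd-product-cong j λ p → cong f (swap p)) ⟩
  odd-product (2 + j) f ∎
  where
  open ≡-Reasoning
  j : ℕ
  j = k * 2
  α β : Weight
  α = ω-odd j
  β = ω-odd (1 + j)
  swap : ∀ p → α ⊕ (β ⊕ p) ≡ β ⊕ (α ⊕ p)
  swap p = trans (sym (⊕-assoc α β p)) (trans (cong (_⊕ p) (⊕-comm α β)) (⊕-assoc β α p))
  expand : ∀ g → ⟦ odd-lists (1 + j) ⟧ g ≡ odd-product j g + odd-product j (ω (1 + j * 2) ▷ g)
  expand g = trans (⟦⟧-++-prepend₁ (odd-lists j) (1 + j * 2) (odd-lists j) g)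
    (cong₂ _+_ (odd-lists-product k g) (odd-lists-product k (ω (1 + j * 2) ▷ g)))

-- Both counts as coefficients

module _ (u v n : ℕ) where

  -- The last equation is `dilation` with the sum set to n: it fixes the size through the weight
  -- alone and avoids division by 4.
  At : Weight → Set
  At w = wᵤ w ≡ u × wᵥ w ≡ v × 4 * wₛ w ≡ n + u + 3 * v

  at? : Decidable At
  at? w = (wᵤ w ≟ u) ×-dec (wᵥ w ≟ v) ×-dec (4 * wₛ w ≟ n + u + 3 * v)

  At-weight : ∀ {xs} → sum xs ≡ n → wᵤ (weight xs) ≡ u → wᵥ (weight xs) ≡ v → At (weight xs)
  At-weight {xs} s≡ u≡ v≡ =
    u≡ , v≡ , trans (dilation xs) (cong₂ _+_ (cong₂ _+_ s≡ u≡) (cong (3 *_) v≡))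

  At-sum : ∀ {xs} → At (weight xs) → sum xs ≡ n
  At-sum {xs} (refl , refl , s≡) =
    +-cancelʳ-≡ u _ _ (+-cancelʳ-≡ (3 * v) _ _ (trans (sym (dilation xs)) s≡))

  -- Large enough for T₀ K to reach the parts of size n, and for the truncation
  -- in T₀-Light to be invisible.
  K : ℕ
  K = n + u + 3 * v

  n≤K : n ≤ K
  n≤K = ≤-trans (m≤m+n n u) (m≤m+n (n + u) (3 * v))

  χ-at : Test
  χ-at = χ ∘ at?

  -- The test is nonzero only where four times the q-exponent equals `K`, which keeps that exponent
  -- at most `K`.
  Light-χ-at : Light K χ-at
  Light-χ-at w (_ , K<s) = cong (if_then 1 else 0) (dec-false (at? w) λ (_ , _ , e) →
    <⇒≱ K<s (≤-trans (m≤n*m (wₛ w) 4) (≤-reflexive e)))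

  C′₄-odd-lists : C′₄ u v n ≡ ⟦ odd-lists (K * 2) ⟧ χ-at
  C′₄-odd-lists = trans
    (count-⇔ (C′-condition? u v) (at? ∘ weight) (partitions-unique n) (C.unique enum) λ xs → mk⇔
      (λ (xs∈ , c) → to xs (Equivalence.to (∈-partitions n) xs∈) c)
      (λ (xs∈ , a) → let p , c = from xs (C.sound enum xs∈) a
                     in Equivalence.from (∈-partitions n) p , c))
    (count-sum (at? ∘ weight) (odd-lists (K * 2)))
    where
    enum : C.Enumerates (K * 2) (odd-lists (K * 2))
    enum = enum-odd-lists (K * 2)

    chain : ∀ xs → All C-Part xs → Linked _>_ xs → sum xs ≡ n → C.Chain (K * 2) xs
    chain []           _  _ _    = C.[]
    chain (zero ∷ xs)  (inj₁ () ∷ _)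
    chain (zero ∷ xs)  (inj₂ () ∷ _)
    chain (suc x ∷ xs) ps l refl = C.Linked⇒Chain >⇔half ps l (begin
      suc ⌊ suc x /2⌋   ≤⟨ ⌊n/2⌋<n x ⟩
      suc x             ≤⟨ m≤m+n (suc x) (sum xs) ⟩
      sum (suc x ∷ xs)  ≤⟨ n≤K ⟩
      K                 ≤⟨ m≤m*n K 2 ⟩
      K * 2             ∎)
      where open ≤-Reasoning

    to : ∀ xs → IsPartition n xs → C′-Condition u v xs → xs ∈ odd-lists (K * 2) × At (weight xs)
    to xs (_ , l , s≡) (uq , ps , u≡ , v≡) =
      C.complete enum (chain xs ps
        -- Weak decrease and distinctness combine into strict decrease; distinctness concerns all
        -- pairs, so the order is first extended to all pairs by transitivity.
        (AllPairs⇒Linked (AllPairs.zipWith (λ (x≥y , x≢y) → ≤∧≢⇒< x≥y (x≢y ∘ sym))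
          (Linked⇒AllPairs (λ x≥y y≥z → ≤-trans y≥z x≥y) l , uq))) s≡) ,
      At-weight {xs} s≡ (trans (sym (C-count₃ ps)) u≡) (trans (sym (C-count₁ ps)) v≡)

    positive : ∀ {x} → C-Part x → x > 0
    positive {suc _} _         = s≤s z≤n
    positive {zero}  (inj₁ ())
    positive {zero}  (inj₂ ())

    from : ∀ xs → C.Chain (K * 2) xs → At (weight xs) → IsPartition n xs × C′-Condition u v xs
    from xs ch a@(u≡ , v≡ , _) =
      (All.map positive ps , Linked.map <⇒≤ l , At-sum {xs} a) ,
      (AllPairs.map (λ y<x → <⇒≢ y<x ∘ sym) (Linked⇒AllPairs (λ x>y y>z → <-trans y>z x>y) l) ,
       ps , trans (C-count₃ ps) u≡ , trans (C-count₁ ps) v≡)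
      where
      ps : All C-Part xs
      ps = C.Chain⇒All ch
      l : Linked _>_ xs
      l = C.Chain⇒Linked >⇔half ch

  D′₄-T₀ : D′₄ u v n ≡ ⟦ T₀ K ⟧ χ-at
  D′₄-T₀ = trans
    (count-⇔ (D′-condition? u v) (at? ∘ weight) (partitions-unique n) (D.unique enum) λ xs → mk⇔
      (λ (xs∈ , c) → to xs (Equivalence.to (∈-partitions n) xs∈) c)
      (λ (xs∈ , a) → let p , c = from xs (D.sound enum xs∈) a
                     in Equivalence.from (∈-partitions n) p , c))
    (count-sum (at? ∘ weight) (T₀ K))
    where
    enum : D.Enumerates (7 + K * 4) (T₀ K)
    enum = enum-T₀ K

    GapOK⇔ : ∀ {x y} → D-Part x → D-Part y → GapOK x y ⇔ rank y ≤ cap x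
    GapOK⇔ {x} {y} _ _ = GapOK⇔rank x y

    chain : ∀ xs → All D-Part xs → Linked GapOK xs → sum xs ≡ n → D.Chain (7 + K * 4) xs
    chain []       _  _ _    = D.[]
    chain (x ∷ xs) ps l refl = D.Linked⇒Chain GapOK⇔ ps l (begin
      rank x       ≤⟨ rank-bound x ⟩
      x + 7        ≤⟨ +-monoˡ-≤ 7 (≤-trans (m≤m+n x (sum xs)) (≤-trans n≤K (m≤m*n K 4))) ⟩
      K * 4 + 7    ≡⟨ +-comm (K * 4) 7 ⟩
      7 + K * 4    ∎)
      where open ≤-Reasoning

    to : ∀ xs → IsPartition n xs → D′-Condition u v xs → xs ∈ T₀ K × At (weight xs)
    to xs (pos , _ , s≡) (u≡ , v≡ , ≢2 , l) =
      D.complete enum (chain xs (All.zip (pos , ≢2)) l s≡) ,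
      At-weight {xs} s≡ (sym (trans u≡ (uWeight-weight xs))) (sym (trans v≡ (vWeight-weight xs)))

    from : ∀ xs → D.Chain (7 + K * 4) xs → At (weight xs) → IsPartition n xs × D′-Condition u v xs
    from xs ch a@(u≡ , v≡ , _) =
      (All.map proj₁ ps , Linked.map (λ {x} {y} g → <⇒≤ (GapOK⇒> {x} {y} g)) l , At-sum {xs} a) ,
      (trans (sym u≡) (sym (uWeight-weight xs)) , trans (sym v≡) (sym (vWeight-weight xs)) ,
       All.map proj₂ ps , l)
      where
      ps : All D-Part xs
      ps = D.Chain⇒All ch
      l : Linked GapOK xs
      l = D.Chain⇒Linked GapOK⇔ ch

theorem1p9 : ∀ (u v n : ℕ) → C′₄ u v n ≡ D′₄ u v n
theorem1p9 u v n = begin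
  C′₄ u v n                           ≡⟨ C′₄-odd-lists u v n ⟩
  ⟦ odd-lists (k * 2) ⟧ (χ-at u v n)  ≡⟨ odd-lists-product k (χ-at u v n) ⟩
  odd-product (k * 2) (χ-at u v n)    ≡⟨ T₀-Light k (Light-χ-at u v n) ⟨
  ⟦ T₀ k ⟧ (χ-at u v n)               ≡⟨ D′₄-T₀ u v n ⟨
  D′₄ u v n                           ∎
  where
  open ≡-Reasoning
  k : ℕ
  k = K u v n
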